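{- For integers $a \geq 2$ and $n \geq a^2+1$ we have $$t_{n,a} - \left\lfloor \frac{n}{a} \right\rfloor \binom{a}{2} \leq \mathrm{mex}(n;a) \leq t_{n,a} - 1.$$ Thus, for fixed $a \ge 2$, $\mathrm{mex}(n;a) \sim \left(1 - \frac{1}{a}\right)\frac{n^2}{2}$ as $n \to \infty$.
   Context: All graphs are finite, simple and undirected; the order of a graph is its number of vertices and its size is its number of edges. A monophonic path is an induced (chordless) path. A set $S$ of vertices of a graph $G$ is in monophonic position if no monophonic path of $G$ contains more than two elements of $S$; the monophonic position number (mp-number) $\mathrm{mp}(G)$ is the largest size of such a set. For $a \geq 2$ and $n \geq a$, $\mathrm{mex}(n;a)$ is the largest possible size of a graph with order $n$ and mp-number $a$. $T_{n,a}$ denotes the Turán graph, i.e. the complete $a$-partite graph of order $n$ with every partite set of size $\lfloor n/a \rfloor$ or $\lceil n/a \rceil$, and $t_{n,a}$ is its size. -}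

module Defs where

open import Data.Bool.Base using (Bool; true; false; not; T)
open import Data.Fin.Base as Fin using (Fin; toℕ)
open import Data.Fin.Properties as Fin using (toℕ<n; toℕ-fromℕ<; toℕ-injective)
open import Data.Fin.Subset using (Subset; ⋃; ⁅_⁆; _∩_; ∣_∣)
open import Data.List.Base as List using (List; length; filter; allFin; cartesianProduct)
open import Data.Nat.Base as ℕ using (ℕ; zero; suc; _+_; _*_; _∸_; _≤_; _<_; NonZero; s≤s⁻¹)
open import Data.Nat.DivMod
open import Data.Nat.Divisibility using (divides-refl; ∣-refl)
open import Data.Nat.Properties as ℕ
open import Data.Product.Base using (Σ-syntax; ∃-syntax; _×_; _,_)
open import Data.Rational.Base as ℚ using (ℚ; 0ℚ; 1ℚ)
open import Data.Sum.Base using (_⊎_; inj₁; inj₂)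
open import Data.Vec.Base as Vec using (tabulate)
open import Data.Vec.Properties using (tabulate-cong)
open import Function.Base using (_∘_)
open import Function.Definitions using (Injective)
open import Relation.Binary.Definitions using (tri<; tri≈; tri>)
open import Relation.Binary.PropositionalEquality
open import Relation.Nullary using (¬_; does; yes; no)
open import Relation.Nullary.Decidable using (dec-true; dec-false; T?; _×-dec_)

private
  variable
    n : ℕ

IsGreatest : (ℕ → Set) → ℕ → Set
IsGreatest P m = P m × (∀ k → P k → k ≤ m)

record Graph (n : ℕ) : Set where
  field
    adj        : Fin n → Fin n → Bool
    adj-sym    : ∀ u v → adj u v ≡ adj v u
    adj-irrefl : ∀ v → adj v v ≡ false

  Adj : Fin n → Fin n → Set
  Adj u v = T (adj u v)

  -- Each edge {u , v} is listed once, as the pair with u < v.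
  edges : List (Fin n × Fin n)
  edges = filter (λ (u , v) → (u Fin.<? v) ×-dec T? (adj u v))
                 (cartesianProduct (allFin n) (allFin n))

  size : ℕ
  size = length edges

open Graph public using (Adj; size)

record MonophonicPath (G : Graph n) (k : ℕ) : Set where
  field
    vertex    : Fin k → Fin n
    distinct  : Injective _≡_ _≡_ vertex
    path      : ∀ i j → toℕ j ≡ suc (toℕ i) → Adj G (vertex i) (vertex j)
    chordless : ∀ i j → suc (toℕ i) < toℕ j → ¬ Adj G (vertex i) (vertex j)

  vertices : Subset n
  vertices = ⋃ (List.tabulate λ i → ⁅ vertex i ⁆)

InMonophonicPosition : Graph n → Subset n → Set
InMonophonicPosition G S =
  ∀ {k} (P : MonophonicPath G k) → ∣ S ∩ MonophonicPath.vertices P ∣ ≤ 2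

IsMpNumber : Graph n → ℕ → Set
IsMpNumber {n} G = IsGreatest λ s →
  ∃[ S ] InMonophonicPosition G S × ∣ S ∣ ≡ s

-- `IsMex n a m` says that mex(n;a) is defined and equal to m.
IsMex : ℕ → ℕ → ℕ → Set
IsMex n a = IsGreatest λ m →
  Σ[ G ∈ Graph n ] IsMpNumber G a × size G ≡ m

-- The partite sets are the fibres of c.
completeMultipartite : ∀ {a} → (Fin n → Fin a) → Graph n
completeMultipartite c = record
  { adj        = λ u v → not (does (c u Fin.≟ c v))
  ; adj-sym    = λ u v → cong not (does-sym (c u) (c v))
  ; adj-irrefl = λ v → cong not (dec-true (c v Fin.≟ c v) refl)
  }
  where
  does-sym : ∀ {a} (x y : Fin a) → does (x Fin.≟ y) ≡ does (y Fin.≟ x)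
  does-sym x y with x Fin.≟ y
  ... | yes x≡y = sym (dec-true (y Fin.≟ x) (sym x≡y))
  ... | no  x≢y = sym (dec-false (y Fin.≟ x) (x≢y ∘ sym))

partiteSet : ∀ {a} → (Fin n → Fin a) → Fin a → Subset n
partiteSet c p = tabulate λ v → does (c v Fin.≟ p)

-- The vertices are distributed cyclically over the a parts; `turánPart-balanced`
-- below shows that every part has size ⌊n/a⌋ or ⌈n/a⌉.
turánPart : ∀ n a .{{_ : NonZero a}} → Fin n → Fin a
turánPart n a v = toℕ v mod a

turán : ∀ n a .{{_ : NonZero a}} → Graph n
turán n a = completeMultipartite (turánPart n a)

t : ∀ n a .{{_ : NonZero a}} → ℕ
t n a = size (turán n a)

-- f n / g n → 1; in particular g n is eventually nonzero.  Rational ε suffice.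
_∼_ : (ℕ → ℚ) → (ℕ → ℚ) → Set
f ∼ g = ∀ (ε : ℚ) → 0ℚ ℚ.< ε → ∃[ N ] ∀ n → N ≤ n →
  Σ[ g≢0 ∈ ℚ.NonZero (g n) ] ℚ.∣ (ℚ._÷_ (f n) (g n) {{g≢0}}) ℚ.- 1ℚ ∣ ℚ.< ε

infix 4 _∼_

private
  [r+q*a]/a≡q : ∀ {r} q a .{{_ : NonZero a}} → r < a → (r + q * a) / a ≡ q
  [r+q*a]/a≡q {r} q a r<a = begin
    (r + q * a) / a     ≡⟨ +-distrib-/-∣ʳ r (divides-refl q) ⟩
    r / a + q * a / a   ≡⟨ cong₂ _+_ (m<n⇒m/n≡0 r<a) (m*n/n≡m q a) ⟩
    q                   ∎
    where open ≡-Reasoning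

  bit : Bool → ℕ
  bit true  = 1
  bit false = 0

  ∣∷∣ : ∀ b (S : Subset n) → ∣ b Vec.∷ S ∣ ≡ bit b + ∣ S ∣
  ∣∷∣ true  S = refl
  ∣∷∣ false S = refl

  module _ (a : ℕ) .{{_ : NonZero a}} (p : Fin a) where
    c d : ℕ
    c = toℕ p
    d = a ∸ suc c

    c+1+d≡a : suc c + d ≡ a
    c+1+d≡a = m+[n∸m]≡n (toℕ<n p)

    hit : ℕ → Bool
    hit s = does ((s mod a) Fin.≟ p)

    step : ∀ s → bit (hit s) + (s + d) / a ≡ (suc s + d) / a
    step s = go (<-cmp r c)
      where
      r q : ℕ
      r = s % a
      q = s / a

      split : ∀ x → s + x ≡ (r + x) + q * a
      split x = begin
        s + x            ≡⟨ cong (_+ x) (m≡m%n+[m/n]*n s a) ⟩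
        r + q * a + x    ≡⟨ +-assoc r (q * a) x ⟩
        r + (q * a + x)  ≡⟨ cong (r +_) (+-comm (q * a) x) ⟩
        r + (x + q * a)  ≡⟨ sym (+-assoc r x (q * a)) ⟩
        r + x + q * a    ∎
        where open ≡-Reasoning

      quot : ∀ x → r + x < a → (s + x) / a ≡ q
      quot x lt = trans (/-congˡ (split x)) ([r+q*a]/a≡q q a lt)

      quot′ : ∀ x y → r + x ≡ y + a → y < a → (s + x) / a ≡ suc q
      quot′ x y eq lt = trans (/-congˡ (begin
        s + x            ≡⟨ split x ⟩
        r + x + q * a    ≡⟨ cong (_+ q * a) eq ⟩
        y + a + q * a    ≡⟨ +-assoc y a (q * a) ⟩
        y + suc q * a    ∎)) ([r+q*a]/a≡q (suc q) a lt)
        where open ≡-Reasoning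

      toℕ-mod : toℕ (s mod a) ≡ r
      toℕ-mod = toℕ-fromℕ< (m%n<n s a)

      miss : r ≢ c → hit s ≡ false
      miss r≢c = dec-false ((s mod a) Fin.≟ p)
        λ eq → r≢c (trans (sym toℕ-mod) (cong toℕ eq))

      shift : (suc s + d) / a ≡ (s + suc d) / a
      shift = /-congˡ (sym (+-suc s d))

      c+[1+d]≡a : c + suc d ≡ a
      c+[1+d]≡a = trans (+-suc c d) c+1+d≡a

      1+d≤a : suc d ≤ a
      1+d≤a = ≤-trans (m≤n+m (suc d) c) (≤-reflexive c+[1+d]≡a)

      go : _ → bit (hit s) + (s + d) / a ≡ (suc s + d) / a
      go (tri< r<c r≢c _) rewrite miss r≢c = trans
        (quot d (≤-trans (+-monoˡ-< d (≤-trans r<c (n≤1+n c))) (≤-reflexive c+1+d≡a)))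
        (sym (trans shift (quot (suc d)
          (≤-trans (+-monoˡ-< (suc d) r<c) (≤-reflexive c+[1+d]≡a)))))
      go (tri≈ _ r≡c _)
        rewrite dec-true ((s mod a) Fin.≟ p) (toℕ-injective (trans toℕ-mod r≡c)) = trans
        (cong suc (quot d (≤-reflexive (trans (cong (λ x → suc (x + d)) r≡c) c+1+d≡a))))
        (sym (trans shift (quot′ (suc d) 0
          (trans (cong (_+ suc d) r≡c) c+[1+d]≡a) (ℕ.≤-trans (ℕ.s≤s ℕ.z≤n) 1+d≤a))))
      go (tri> _ r≢c c<r) rewrite miss r≢c = trans
        (quot′ d e r+d≡e+a (≤-trans (n≤1+n (suc e)) 2+e≤a))
        (sym (trans shift (quot′ (suc d) (suc e)
          (trans (+-suc r d) (cong suc r+d≡e+a)) 2+e≤a)))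
        where
        e : ℕ
        e = r ∸ suc c

        r≡ : e + suc c ≡ r
        r≡ = m∸n+n≡m c<r

        r+d≡e+a : r + d ≡ e + a
        r+d≡e+a = trans (cong (_+ d) (sym r≡))
          (trans (+-assoc e (suc c) d) (cong (e +_) c+1+d≡a))

        2+e≤a : suc (suc e) ≤ a
        2+e≤a = ≤-trans (ℕ.s≤s (≤-trans (ℕ.s≤s (m≤m+n e c))
          (≤-reflexive (trans (sym (+-suc e c)) r≡)))) (m%n<n s a)

    count : ∀ n s → ∣ tabulate {n = n} (λ v → hit (s + toℕ v)) ∣ + (s + d) / a
                    ≡ (s + n + d) / a
    count zero    s = /-congˡ (cong (_+ d) (sym (+-identityʳ s)))
    count (suc n) s = begin
      ∣ hit (s + 0) Vec.∷ tail ∣ + (s + d) / a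
        ≡⟨ cong (_+ (s + d) / a) (∣∷∣ (hit (s + 0)) tail) ⟩
      bit (hit (s + 0)) + ∣ tail ∣ + (s + d) / a
        ≡⟨ cong₂ (λ x y → bit (hit x) + y + (s + d) / a) (+-identityʳ s)
             (cong (λ S → ∣_∣ {n} S) (tabulate-cong (λ v → cong hit (+-suc s (toℕ v))))) ⟩
      bit (hit s) + ∣ tail′ ∣ + (s + d) / a
        ≡⟨ cong (_+ (s + d) / a) (+-comm (bit (hit s)) ∣ tail′ ∣) ⟩
      ∣ tail′ ∣ + bit (hit s) + (s + d) / a
        ≡⟨ +-assoc ∣ tail′ ∣ (bit (hit s)) _ ⟩
      ∣ tail′ ∣ + (bit (hit s) + (s + d) / a)
        ≡⟨ cong (∣ tail′ ∣ +_) (step s) ⟩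
      ∣ tail′ ∣ + (suc s + d) / a
        ≡⟨ count n (suc s) ⟩
      (suc s + n + d) / a
        ≡⟨ /-congˡ (cong (_+ d) (sym (+-suc s n))) ⟩
      (s + suc n + d) / a ∎
      where
      open ≡-Reasoning
      tail tail′ : Subset n
      tail  = tabulate (λ v → hit (s + suc (toℕ v)))
      tail′ = tabulate (λ v → hit (suc s + toℕ v))

    partSize : ∀ n → ∣ partiteSet (turánPart n a) p ∣ ≡ (n + d) / a
    partSize n = begin
      ∣ partiteSet (turánPart n a) p ∣            ≡⟨ sym (+-identityʳ _) ⟩
      ∣ partiteSet (turánPart n a) p ∣ + 0        ≡⟨ cong (∣ partiteSet (turánPart n a) p ∣ +_) (sym (m<n⇒m/n≡0 d<a)) ⟩
      ∣ partiteSet (turánPart n a) p ∣ + d / a    ≡⟨ count n 0 ⟩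
      (n + d) / a                                 ∎
      where
      open ≡-Reasoning
      d<a : d < a
      d<a = ≤-trans (ℕ.s≤s (m≤n+m d c)) (≤-reflexive c+1+d≡a)

-- ⌈n/a⌉ is written (n + (a ∸ 1)) / a.
turánPart-balanced : ∀ n a .{{_ : NonZero a}} (p : Fin a) →
  ∣ partiteSet (turánPart n a) p ∣ ≡ n / a ⊎
  ∣ partiteSet (turánPart n a) p ∣ ≡ (n + (a ∸ 1)) / a
turánPart-balanced n a p rewrite partSize a p n with (n + d a p) / a ℕ.≤? n / a
... | yes x≤ = inj₁ (≤-antisym x≤ (/-monoˡ-≤ a (m≤m+n n (d a p))))
... | no  x≰ = inj₂ (≤-antisym upper (≤-trans ceil≤ (≰⇒> x≰)))
  where
  upper : (n + d a p) / a ≤ (n + (a ∸ 1)) / a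
  upper = /-monoˡ-≤ a (+-monoʳ-≤ n (∸-monoʳ-≤ a (ℕ.s≤s ℕ.z≤n)))
  ceil≤ : (n + (a ∸ 1)) / a ≤ suc (n / a)
  ceil≤ = ≤-trans (/-monoˡ-≤ a (+-monoʳ-≤ n (m∸n≤m a 1)))
    (≤-reflexive (trans (+-distrib-/-∣ʳ n ∣-refl)
      (trans (cong (n / a +_) (n/n≡1 a)) (+-comm (n / a) 1))))

{-# OPTIONS --safe #-}
-- Upper bound.  An induced path meets a clique in at most two vertices, so cliques are in
-- monophonic position and a graph with mp-number a contains no K_{a+1}; Turán's theorem bounds
-- its size by t_{n,a}.  Both the bound and its equality case follow by induction, deleting a
-- vertex of degree at most n − ⌊n/a⌋ (if there is none, a K_{a+1} is found greedily).  A graph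
-- attaining t_{n,a} is complete a-partite; its parts are in monophonic position, and as n > a²
-- one of them has more than a vertices, so the mp-number is not a.
--
-- Lower bound.  Arrange the vertices in rows of length a, whose columns are the parts of the
-- Turán graph, and delete the edges inside the ⌊n/a⌋ full rows.  Any two vertices in a column
-- lie on a common induced path with any third vertex, so by the pigeonhole principle at most a
-- vertices are in monophonic position; the diagonal is a clique of size a.
--
-- The asymptotic formula follows from 2a t_{n,a} = (a − 1) n² + O(n).
module Submission where

open import Defs
open import Data.Integer.Base using (+_)
open import Data.Nat.Base using (ℕ; NonZero; _+_; _*_; _∸_; _^_; _≤_; _≥_)
open import Data.Nat.Combinatorics using (_C_)
open import Data.Nat.DivMod using (_/_)
open import Data.Product.Base using (∃-syntax; _×_)
open import Data.Rational.Base as ℚ using (1ℚ)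

open import Data.Bool.Base using (Bool; true; false; _∧_; _∨_; not; T)
open import Data.Bool.Properties using (∨-comm; ∨-idem)
open import Data.Empty using (⊥)
open import Data.Fin.Base as Fin
  using (Fin; zero; suc; toℕ; fromℕ; fromℕ<; inject₁; punchIn; punchOut;
         combine; remQuot; finToFun; funToFin)
open import Data.Fin.Patterns using (0F; 1F; 2F; 3F; 4F)
open import Data.Fin.Properties as Fin
  using (toℕ<n; toℕ-injective; toℕ-inject₁; toℕ-fromℕ; toℕ-fromℕ<; punchIn-punchOut;
         finToFun-funToFin; remQuot-combine; injective⇒≤; pigeonhole; any?; all?; ¬∀⟶∃¬)
open import Data.Fin.Subset
  using (Subset; inside; outside; ⋃; ⁅_⁆; _∩_; ∣_∣; _∈_; _-_)
open import Data.Fin.Subset.Properties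
  using (∉⊥; x∈p∪q⁻; x∈p∪q⁺; x∈⁅x⁆; x∈⁅y⁆⇒x≡y; x∈p∩q⁺; x∈p∩q⁻;
         x∈p⇒∣p-x∣<∣p∣; x∈p∧x≢y⇒x∈p-y; anySubset?)
open import Data.Integer.Base as ℤ using (+[1+_]; +<+; +≤+)
open import Data.Integer.Properties as ℤ using (pos-*)
open import Data.List.Base as List using (length; filter; cartesianProduct; _++_)
open import Data.List.Properties using (filter-++; length-++; map-tabulate; tabulate-cong)
open import Data.Nat.Base as ℕ using (zero; suc; _<_; z≤n; s≤s)
open import Data.Nat.Combinatorics using (nC1≡n; nCk+nC[k+1]≡[n+1]C[k+1])
open import Data.Nat.DivMod
  using (_%_; _mod_; m<n⇒m%n≡m; [m+n]%n≡m%n; [m+kn]%n≡m%n; m≡m%n+[m/n]*n; m%n<n;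
         m/n≤m; m/n*n≤m; m<n*o⇒m/o<n; m<n⇒m/n≡0; m*n/n≡m; +-distrib-/-∣ʳ; /-monoˡ-≤)
open import Data.Nat.Divisibility using (divides-refl)
open import Data.Nat.Properties
open import Data.Nat.Solver using (module +-*-Solver)
open import Data.Product.Base using (Σ-syntax; _,_; proj₁; proj₂)
open import Data.Rational.Base using (ℚ; 0ℚ; mkℚ; toℚᵘ; *<*; *≤*)
open import Data.Rational.Properties as ℚ
  using (toℚᵘ-injective; toℚᵘ-cancel-≤; toℚᵘ-cancel-<; toℚᵘ-fromℚᵘ;
         toℚᵘ-homo-+; toℚᵘ-homo-*; toℚᵘ-homo‿-)
open import Data.Rational.Unnormalised.Base as ℚᵘ using (mkℚᵘ; *≡*; *<*; *≤*; _≃_)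
open import Data.Rational.Unnormalised.Properties as ℚᵘ using (≃-trans; ≃-sym; ≃-refl)
open import Data.Sum.Base using (_⊎_; inj₁; inj₂)
open import Data.Unit.Base using (tt)
open import Data.Vec.Base as Vec using (here; there)
open import Data.Vec.Functional as Vector using (insertAt)
open import Data.Vec.Functional.Properties using (insertAt-lookup; insertAt-punchIn)
open import Data.Vec.Properties using (lookup∘tabulate; []=⇒lookup)
open import Function.Base using (_∘_; id)
open import Function.Bundles using (mk⇔)
open import Function.Definitions using (Injective)
open import Level using (0ℓ)
open import Relation.Binary.Definitions using (tri<; tri≈; tri>)
open import Relation.Binary.PropositionalEquality
open import Relation.Nullary using (¬_; Dec; does; yes; no; contradiction)
open import Relation.Nullary.Decidable
  using (dec-true; dec-false; does-⇔; map′; T?; ¬?; _×-dec_; _→-dec_)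
open import Relation.Unary using (Pred; Decidable)

open import Algebra.Properties.AbelianGroup ℚ.+-0-abelianGroup
  using (xyx⁻¹≈y; ⁻¹-anti-homo-//)
open import Algebra.Properties.CommutativeMonoid.Sum +-0-commutativeMonoid
  using (sum; sum-syntax; sum-cong-≗; sum-remove; sum-init-last; ∑-distrib-+; ∑-comm)
open import Algebra.Properties.CommutativeSemigroup +-commutativeSemigroup
  using () renaming (interchange to +-interchange)

-- Finite sums and the size of a graph

⟦_⟧ : Bool → ℕ
⟦ true  ⟧ = 1
⟦ false ⟧ = 0

⟦b⟧≤1 : ∀ b → ⟦ b ⟧ ≤ 1
⟦b⟧≤1 true  = ≤-refl
⟦b⟧≤1 false = z≤n

⟦b⟧+⟦¬b⟧≡1 : ∀ b → ⟦ b ⟧ + ⟦ not b ⟧ ≡ 1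
⟦b⟧+⟦¬b⟧≡1 true  = refl
⟦b⟧+⟦¬b⟧≡1 false = refl

sum-mono-≤ : ∀ {n} {f g : Fin n → ℕ} → (∀ i → f i ≤ g i) → sum f ≤ sum g
sum-mono-≤ {zero}  f≤g = z≤n
sum-mono-≤ {suc n} f≤g = +-mono-≤ (f≤g zero) (sum-mono-≤ (f≤g ∘ suc))

sum-≤-* : ∀ {n} {f : Fin n → ℕ} c → (∀ i → f i ≤ c) → sum f ≤ n * c
sum-≤-* {zero}  c f≤c = z≤n
sum-≤-* {suc n} c f≤c = +-mono-≤ (f≤c zero) (sum-≤-* c (f≤c ∘ suc))

n≤sum : ∀ {n} {f : Fin n → ℕ} → (∀ i → 1 ≤ f i) → n ≤ sum f
n≤sum {zero}  1≤f = z≤n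
n≤sum {suc n} 1≤f = +-mono-≤ (1≤f zero) (n≤sum (1≤f ∘ suc))

fᵢ≤sum : ∀ {n} (f : Fin n → ℕ) i → f i ≤ sum f
fᵢ≤sum f zero    = m≤m+n _ _
fᵢ≤sum f (suc i) = ≤-trans (fᵢ≤sum (f ∘ suc) i) (m≤n+m _ _)

-- Serves the equality case of Turán's theorem: for a graph contained in another one of no larger
-- degree sum, it applies first to the degrees and then to the adjacency indicators of each row.
sum-mono-≤-tight : ∀ {n} {f g : Fin n → ℕ} → (∀ i → f i ≤ g i) →
  sum g ≤ sum f → ∀ i → g i ≤ f i
sum-mono-≤-tight {suc n} {f} {g} f≤g Σg≤Σf zero =
  +-cancelʳ-≤ (sum (g ∘ suc)) _ _
    (≤-trans Σg≤Σf (+-monoʳ-≤ (f zero) (sum-mono-≤ (f≤g ∘ suc))))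
sum-mono-≤-tight {suc n} {f} {g} f≤g Σg≤Σf (suc i) =
  sum-mono-≤-tight (f≤g ∘ suc)
    (+-cancelˡ-≤ (g zero) _ _
      (≤-trans Σg≤Σf (+-monoˡ-≤ (sum (f ∘ suc)) (f≤g zero)))) i

length-filter-tabulate : ∀ {A : Set} {P : Pred A 0ℓ} (P? : Decidable P) {n} (f : Fin n → A) →
  length (filter P? (List.tabulate f)) ≡ ∑[ i < n ] ⟦ does (P? (f i)) ⟧
length-filter-tabulate P? {zero}  f = refl
length-filter-tabulate P? {suc n} f with does (P? (f zero))
... | true  = cong suc (length-filter-tabulate P? (f ∘ suc))
... | false = length-filter-tabulate P? (f ∘ suc)

length-filter-cartesianProduct : ∀ {A B : Set} {P : Pred (A × B) 0ℓ} (P? : Decidable P) {m n}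
  (f : Fin m → A) (g : Fin n → B) →
  length (filter P? (cartesianProduct (List.tabulate f) (List.tabulate g))) ≡
  ∑[ i < m ] ∑[ j < n ] ⟦ does (P? (f i , g j)) ⟧
length-filter-cartesianProduct P? {zero}  f g = refl
length-filter-cartesianProduct P? {suc m} f g = begin
  length (filter P? (row ++ rest))
    ≡⟨ cong length (filter-++ P? row rest) ⟩
  length (filter P? row ++ filter P? rest)
    ≡⟨ length-++ (filter P? row) ⟩
  length (filter P? row) + length (filter P? rest)
    ≡⟨ cong₂ _+_
         (trans (cong (length ∘ filter P?) (map-tabulate g (f zero ,_)))
                (length-filter-tabulate P? (λ j → f zero , g j)))
         (length-filter-cartesianProduct P? (f ∘ suc) g) ⟩
  _ ∎
  where
  open ≡-Reasoning
  row  = List.map (f zero ,_) (List.tabulate g)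
  rest = cartesianProduct (List.tabulate (f ∘ suc)) (List.tabulate g)

module _ {n} (G : Graph n) where
  open Graph G using (adj; adj-sym; adj-irrefl)

  size-∑ : size G ≡ ∑[ u < n ] ∑[ v < n ] ⟦ does (u Fin.<? v) ∧ adj u v ⟧
  size-∑ = length-filter-cartesianProduct
    (λ (u , v) → (u Fin.<? v) ×-dec T? (adj u v)) id id

  degree : Fin n → ℕ
  degree u = ∑[ v < n ] ⟦ adj u v ⟧

  degreeSum : ℕ
  degreeSum = sum degree

  -- Each adjacency indicator splits by which end is the smaller one. Exchanging the two sums turns
  -- the second half into the first.
  handshake : degreeSum ≡ size G + size G
  handshake = begin
    ∑[ u < n ] ∑[ v < n ] ⟦ adj u v ⟧
      ≡⟨ sum-cong-≗ (λ u → trans (sum-cong-≗ (orient u)) (∑-distrib-+ (up u) _)) ⟩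
    ∑[ u < n ] (sum (up u) + ∑[ v < n ] up v u)
      ≡⟨ ∑-distrib-+ (sum ∘ up) _ ⟩
    ∑[ u < n ] sum (up u) + ∑[ u < n ] ∑[ v < n ] up v u
      ≡⟨ cong₂ _+_ (sym size-∑) (trans (∑-comm (λ u v → up v u)) (sym size-∑)) ⟩
    size G + size G ∎
    where
    open ≡-Reasoning
    up : Fin n → Fin n → ℕ
    up u v = ⟦ does (u Fin.<? v) ∧ adj u v ⟧

    orient : ∀ u v → ⟦ adj u v ⟧ ≡ up u v + up v u
    orient u v with Fin.<-cmp u v
    ... | tri< u<v _ v≮u rewrite dec-true (u Fin.<? v) u<v | dec-false (v Fin.<? u) v≮u =
      sym (+-identityʳ _)
    ... | tri≈ u≮u refl _ rewrite dec-false (u Fin.<? u) u≮u | adj-irrefl u = refl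
    ... | tri> u≮v _ v<u rewrite dec-false (u Fin.<? v) u≮v | dec-true (v Fin.<? u) v<u =
      cong ⟦_⟧ (adj-sym u v)

-- The recursion splits off the last index, so that passing from order `n` to `suc n` adds one
-- summand, the contribution of the new vertex `n`.
sumTo : (ℕ → ℕ) → ℕ → ℕ
sumTo f zero    = 0
sumTo f (suc n) = sumTo f n + f n

sumTo-cong : ∀ {f g} n → (∀ i → i < n → f i ≡ g i) → sumTo f n ≡ sumTo g n
sumTo-cong zero    f≡g = refl
sumTo-cong (suc n) f≡g =
  cong₂ _+_ (sumTo-cong n (λ i i<n → f≡g i (m<n⇒m<1+n i<n))) (f≡g n ≤-refl)

sumTo-mono-≤ : ∀ {f g} n → (∀ i → i < n → f i ≤ g i) → sumTo f n ≤ sumTo g n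
sumTo-mono-≤ zero    f≤g = z≤n
sumTo-mono-≤ (suc n) f≤g =
  +-mono-≤ (sumTo-mono-≤ n (λ i i<n → f≤g i (m<n⇒m<1+n i<n))) (f≤g n ≤-refl)

sumTo-distrib-+ : ∀ f g n → sumTo (λ i → f i + g i) n ≡ sumTo f n + sumTo g n
sumTo-distrib-+ f g zero    = refl
sumTo-distrib-+ f g (suc n) rewrite sumTo-distrib-+ f g n =
  +-interchange (sumTo f n) (sumTo g n) (f n) (g n)

sumTo-const : ∀ c n → sumTo (λ _ → c) n ≡ n * c
sumTo-const c zero    = refl
sumTo-const c (suc n) = trans (cong (_+ c) (sumTo-const c n)) (+-comm (n * c) c)

sumTo-zero : ∀ {f} n → (∀ i → i < n → f i ≡ 0) → sumTo f n ≡ 0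
sumTo-zero n f≡0 = trans (sumTo-cong n f≡0) (trans (sumTo-const 0 n) (*-zeroʳ n))

sumTo-+ : ∀ f m n → sumTo f (m + n) ≡ sumTo f m + sumTo (λ i → f (m + i)) n
sumTo-+ f m zero    = trans (cong (sumTo f) (+-identityʳ m)) (sym (+-identityʳ _))
sumTo-+ f m (suc n) = begin
  sumTo f (m + suc n)                                       ≡⟨ cong (sumTo f) (+-suc m n) ⟩
  sumTo f (m + n) + f (m + n)                               ≡⟨ cong (_+ f (m + n)) (sumTo-+ f m n) ⟩
  sumTo f m + sumTo (λ i → f (m + i)) n + f (m + n)         ≡⟨ +-assoc (sumTo f m) _ _ ⟩
  sumTo f m + sumTo (λ i → f (m + i)) (suc n)               ∎
  where open ≡-Reasoning

sum-toℕ : ∀ f n → ∑[ i < n ] f (toℕ i) ≡ sumTo f n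
sum-toℕ f zero    = refl
sum-toℕ f (suc n) = begin
  ∑[ i < suc n ] f (toℕ i)
    ≡⟨ sum-init-last (λ (i : Fin (suc n)) → f (toℕ i)) ⟩
  ∑[ i < n ] f (toℕ (inject₁ i)) + f (toℕ (fromℕ n))
    ≡⟨ cong₂ _+_ (trans (sum-cong-≗ {n = n} (λ i → cong f (toℕ-inject₁ i))) (sum-toℕ f n))
                 (cong f (toℕ-fromℕ n)) ⟩
  sumTo f n + f n ∎
  where open ≡-Reasoning

sumTo-initial : ∀ (B : ℕ → Bool) {m n} → m ≤ n →
  sumTo (λ i → ⟦ does (i <? m) ∧ B i ⟧) n ≡ sumTo (λ i → ⟦ B i ⟧) m
sumTo-initial B {m} {n} m≤n = begin
  sumTo f n
    ≡⟨ cong (sumTo f) (sym (m+[n∸m]≡n m≤n)) ⟩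
  sumTo f (m + (n ∸ m))
    ≡⟨ sumTo-+ f m (n ∸ m) ⟩
  sumTo f m + sumTo (λ i → f (m + i)) (n ∸ m)
    ≡⟨ cong₂ _+_
         (sumTo-cong m (λ i i<m → cong (λ b → ⟦ b ∧ B i ⟧) (dec-true (i <? m) i<m)))
         (sumTo-zero (n ∸ m) (λ i _ →
           cong (λ b → ⟦ b ∧ B (m + i) ⟧) (dec-false (m + i <? m) (m+n≮m m i)))) ⟩
  sumTo (λ i → ⟦ B i ⟧) m + 0
    ≡⟨ +-identityʳ _ ⟩
  sumTo (λ i → ⟦ B i ⟧) m ∎
  where
  open ≡-Reasoning
  f : ℕ → ℕ
  f i = ⟦ does (i <? m) ∧ B i ⟧

-- Each edge is counted at its larger end.
size-sumTo : ∀ {n} (G : Graph n) (A : ℕ → ℕ → Bool) →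
  (∀ u v → Graph.adj G u v ≡ A (toℕ u) (toℕ v)) →
  size G ≡ sumTo (λ v → sumTo (λ u → ⟦ A u v ⟧) v) n
size-sumTo {n} G A adj≡A = begin
  size G
    ≡⟨ size-∑ G ⟩
  ∑[ u < n ] ∑[ v < n ] ⟦ does (u Fin.<? v) ∧ Graph.adj G u v ⟧
    ≡⟨ sum-cong-≗ {n = n} (λ u → sum-cong-≗ {n = n} (λ v →
         cong (λ b → ⟦ does (u Fin.<? v) ∧ b ⟧) (adj≡A u v))) ⟩
  ∑[ u < n ] ∑[ v < n ] f (toℕ u) (toℕ v)
    ≡⟨ ∑-comm {n} {n} (λ u v → f (toℕ u) (toℕ v)) ⟩
  ∑[ v < n ] ∑[ u < n ] f (toℕ u) (toℕ v)
    ≡⟨ sum-cong-≗ {n = n} (λ v → sum-toℕ (λ u → f u (toℕ v)) n) ⟩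
  ∑[ v < n ] sumTo (λ u → f u (toℕ v)) n
    ≡⟨ sum-toℕ (λ v → sumTo (λ u → f u v) n) n ⟩
  sumTo (λ v → sumTo (λ u → f u v) n) n
    ≡⟨ sumTo-cong n (λ v v<n → sumTo-initial (λ u → A u v) (<⇒≤ v<n)) ⟩
  sumTo (λ v → sumTo (λ u → ⟦ A u v ⟧) v) n ∎
  where
  open ≡-Reasoning
  f : ℕ → ℕ → ℕ
  f u v = ⟦ does (u <? v) ∧ A u v ⟧

-- Turán's theorem

¬T-≡ : ∀ {b} → ¬ T b → b ≡ false
¬T-≡ {true}  ¬t = contradiction tt ¬t
¬T-≡ {false} _  = refl

Adj-sym : ∀ {n} (G : Graph n) {u v} → Adj G u v → Adj G v u
Adj-sym G {u} {v} = subst T (Graph.adj-sym G u v)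

Adj-irrefl : ∀ {n} (G : Graph n) {v} → ¬ Adj G v v
Adj-irrefl G {v} = subst T (Graph.adj-irrefl G v)

-- Distinct indices give distinct vertices, since adjacency is irreflexive.
IsClique : ∀ {n k} → Graph n → (Fin k → Fin n) → Set
IsClique G K = ∀ i j → i ≢ j → Adj G (K i) (K j)

CliqueFree : ∀ {n} → ℕ → Graph n → Set
CliqueFree k G = ∀ (K : Fin k → Fin _) → ¬ IsClique G K

module _ {n} (G : Graph n) where
  open Graph G using (adj)

  clique-∷ : ∀ {k u} {K : Fin k → Fin n} → (∀ i → Adj G u (K i)) →
    IsClique G K → IsClique G (u Vector.∷ K)
  clique-∷ u~K clique zero    zero    i≢j = contradiction refl i≢j
  clique-∷ u~K clique zero    (suc j) i≢j = u~K j
  clique-∷ u~K clique (suc i) zero    i≢j = Adj-sym G (u~K i)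
  clique-∷ u~K clique (suc i) (suc j) i≢j = clique i j (i≢j ∘ cong suc)

  -- The vertex `u` itself is counted too, so that degree and codegree add up to `n`.
  codegree : Fin n → ℕ
  codegree u = ∑[ v < n ] ⟦ not (adj u v) ⟧

  degree+codegree : ∀ u → degree G u + codegree u ≡ n
  degree+codegree u = trans (sym (∑-distrib-+ (λ v → ⟦ adj u v ⟧) _))
    (≤-antisym
      (≤-trans (sum-≤-* 1 (λ v → ≤-reflexive (⟦b⟧+⟦¬b⟧≡1 (adj u v)))) (≤-reflexive (*-identityʳ n)))
      (n≤sum (λ v → ≤-reflexive (sym (⟦b⟧+⟦¬b⟧≡1 (adj u v))))))

  -- A clique of `k ≤ a` vertices can be extended: its members together have at most
  -- `k * d ≤ a * d < n` non-neighbours, themselves included, so some vertex is adjacent to all of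
  -- them.
  greedyClique : ∀ {a d} → (∀ v → codegree v ≤ d) → a * d < n →
    ∀ k → k ≤ suc a → ∃[ K ] IsClique {k = k} G K
  greedyClique codeg≤d ad<n zero    _     = (λ ()) , (λ ())
  greedyClique {a} {d} codeg≤d ad<n (suc k) (s≤s k≤a)
    with K , clique ← greedyClique codeg≤d ad<n k (m≤n⇒m≤1+n k≤a)
    with any? (λ u → all? (λ i → T? (adj u (K i))))
  ... | yes (u , u~K) = u Vector.∷ K , clique-∷ u~K clique
  ... | no  ∄u        = contradiction ad<n (≤⇒≯ (begin
    n                                             ≤⟨ n≤sum missed ⟩
    ∑[ u < n ] ∑[ i < k ] ⟦ not (adj (K i) u) ⟧   ≡⟨ ∑-comm {n} {k} (λ u i → ⟦ not (adj (K i) u) ⟧) ⟩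
    ∑[ i < k ] codegree (K i)                     ≤⟨ sum-≤-* d (codeg≤d ∘ K) ⟩
    k * d                                         ≤⟨ *-monoˡ-≤ d k≤a ⟩
    a * d                                         ∎))
    where
    open ≤-Reasoning
    missed : ∀ u → 1 ≤ ∑[ i < k ] ⟦ not (adj (K i) u) ⟧
    missed u with i , u≁Kᵢ ← ¬∀⟶∃¬ k _ (λ i → T? (adj u (K i))) (λ u~K → ∄u (u , u~K)) =
      ≤-trans (≤-reflexive (cong (⟦_⟧ ∘ not)
                 (trans (sym (¬T-≡ u≁Kᵢ)) (Graph.adj-sym G u (K i)))))
              (fᵢ≤sum (λ i → ⟦ not (adj (K i) u) ⟧) i)

-- The bound is the number of edges that the Turán graph gains with its vertex `n`. If all degrees
-- exceed it, all codegrees are at most `n / a`, and `a * (n / a) < suc n` lets the greedy choice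
-- reach `suc a` vertices.
lowDegreeVertex : ∀ {n a} .{{_ : NonZero a}} (G : Graph (suc n)) → CliqueFree (suc a) G →
  ∃[ v ] degree G v ≤ n ∸ n / a
lowDegreeVertex {n} {a} G free with any? (λ v → degree G v ≤? n ∸ n / a)
... | yes v = v
... | no ∄v =
  let K , clique = greedyClique G codegree≤ a*[n/a]<1+n (suc a) ≤-refl
  in  contradiction clique (free K)
  where
  a*[n/a]<1+n : a * (n / a) < suc n
  a*[n/a]<1+n = s≤s (≤-trans (≤-reflexive (*-comm a (n / a))) (m/n*n≤m n a))

  codegree≤ : ∀ v → codegree G v ≤ n / a
  codegree≤ v = +-cancelˡ-≤ (suc (n ∸ n / a)) _ _ (begin
    suc (n ∸ n / a) + codegree G v  ≤⟨ +-monoˡ-≤ (codegree G v) (≰⇒> (λ deg≤ → ∄v (v , deg≤))) ⟩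
    degree G v + codegree G v       ≡⟨ degree+codegree G v ⟩
    suc n                           ≡⟨ cong suc (sym (m∸n+n≡m (m/n≤m n a))) ⟩
    suc (n ∸ n / a) + n / a         ∎)
    where open ≤-Reasoning

infixl 6 _-ᵛ_

_-ᵛ_ : ∀ {n} → Graph (suc n) → Fin (suc n) → Graph n
G -ᵛ v = record
  { adj        = λ x y → Graph.adj G (punchIn v x) (punchIn v y)
  ; adj-sym    = λ x y → Graph.adj-sym G (punchIn v x) (punchIn v y)
  ; adj-irrefl = λ x → Graph.adj-irrefl G (punchIn v x)
  }

-ᵛ-cliqueFree : ∀ {n k} (G : Graph (suc n)) v → CliqueFree k G → CliqueFree k (G -ᵛ v)
-ᵛ-cliqueFree G v free K = free (punchIn v ∘ K)

-- Deleting `v` removes a row and a column of the adjacency matrix, and each of them sums to the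
-- degree of `v`.
degreeSum-ᵛ : ∀ {n} (G : Graph (suc n)) v →
  degreeSum G ≡ degreeSum (G -ᵛ v) + (degree G v + degree G v)
degreeSum-ᵛ {n} G v = begin
  degreeSum G
    ≡⟨ sum-remove {i = v} (degree G) ⟩
  degree G v + ∑[ x < n ] degree G (punchIn v x)
    ≡⟨ cong (λ s → degree G v + s)
         (sum-cong-≗ {n = n} (λ x → sum-remove {i = v} (row (punchIn v x)))) ⟩
  degree G v + ∑[ x < n ] (row (punchIn v x) v + degree (G -ᵛ v) x)
    ≡⟨ cong (λ s → degree G v + s) (∑-distrib-+ (λ x → row (punchIn v x) v) (degree (G -ᵛ v))) ⟩
  degree G v + (∑[ x < n ] row (punchIn v x) v + degreeSum (G -ᵛ v))
    ≡⟨ cong (λ d → degree G v + (d + degreeSum (G -ᵛ v))) column ⟩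
  degree G v + (degree G v + degreeSum (G -ᵛ v))
    ≡⟨ sym (+-assoc (degree G v) (degree G v) _) ⟩
  degree G v + degree G v + degreeSum (G -ᵛ v)
    ≡⟨ +-comm (degree G v + degree G v) _ ⟩
  degreeSum (G -ᵛ v) + (degree G v + degree G v) ∎
  where
  open ≡-Reasoning
  open Graph G using (adj; adj-sym; adj-irrefl)
  row : Fin (suc n) → Fin (suc n) → ℕ
  row u w = ⟦ adj u w ⟧
  column : ∑[ x < n ] row (punchIn v x) v ≡ degree G v
  column = trans (sum-cong-≗ {n = n} (λ x → cong ⟦_⟧ (adj-sym (punchIn v x) v)))
    (sym (trans (sum-remove {i = v} (row v))
      (cong (λ b → ⟦ b ⟧ + sum (λ x → row v (punchIn v x))) (adj-irrefl v))))

-- Counting residues and the growth of the Turán graph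

sumTo-singleton : ∀ {p} n → p < n → sumTo (λ i → ⟦ does (i ≟ p) ⟧) n ≡ 1
sumTo-singleton {p} (suc n) p<1+n with p ≟ n
... | yes refl = cong₂ _+_
  (sumTo-zero n (λ i i<n → cong ⟦_⟧ (dec-false (i ≟ n) (<⇒≢ i<n))))
  (cong ⟦_⟧ (dec-true (n ≟ n) refl))
... | no p≢n = cong₂ _+_
  (sumTo-singleton n (≤∧≢⇒< (≤-pred p<1+n) p≢n))
  (cong ⟦_⟧ (dec-false (n ≟ p) (p≢n ∘ sym)))

[n+m]%n≡m%n : ∀ n m .{{_ : NonZero n}} → (n + m) % n ≡ m % n
[n+m]%n≡m%n n m = trans (cong (_% n) (+-comm n m)) ([m+n]%n≡m%n m n)

-- Each of the `q` blocks of `a` consecutive numbers contains the residue `p` once, and the `p`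
-- numbers left over have smaller residues.
count-residue : ∀ {a p} .{{_ : NonZero a}} → p < a → ∀ q →
  sumTo (λ i → ⟦ does (i % a ≟ p) ⟧) (q * a + p) ≡ q
count-residue {a} {p} p<a zero = sumTo-zero p λ i i<p →
  cong ⟦_⟧ (dec-false (i % a ≟ p)
    (<⇒≢ (subst (_< p) (sym (m<n⇒m%n≡m (<-trans i<p p<a))) i<p)))
count-residue {a} {p} p<a (suc q) = begin
  sumTo f (a + q * a + p)
    ≡⟨ cong (sumTo f) (+-assoc a (q * a) p) ⟩
  sumTo f (a + (q * a + p))
    ≡⟨ sumTo-+ f a (q * a + p) ⟩
  sumTo f a + sumTo (λ i → f (a + i)) (q * a + p)
    ≡⟨ cong₂ _+_
         (trans (sumTo-cong a (λ i i<a → cong hit (m<n⇒m%n≡m i<a))) (sumTo-singleton a p<a))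
         (trans (sumTo-cong (q * a + p) (λ i _ → cong hit ([n+m]%n≡m%n a i))) (count-residue p<a q)) ⟩
  suc q ∎
  where
  open ≡-Reasoning
  hit f : ℕ → ℕ
  hit r = ⟦ does (r ≟ p) ⟧
  f i = hit (i % a)

≡-or-punchIn : ∀ {n} (v u : Fin (suc n)) → u ≡ v ⊎ ∃[ x ] u ≡ punchIn v x
≡-or-punchIn v u with v Fin.≟ u
... | yes v≡u = inj₁ (sym v≡u)
... | no  v≢u = inj₂ (punchOut v≢u , sym (punchIn-punchOut v≢u))

module _ (a : ℕ) .{{_ : NonZero a}} where

  samePart : ℕ → ℕ → Bool
  samePart u v = does ((u mod a) Fin.≟ (v mod a))

  toℕ-mod : ∀ u → toℕ (u mod a) ≡ u % a
  toℕ-mod u = toℕ-fromℕ< (m%n<n u a)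

  samePart-% : ∀ u v → samePart u v ≡ does (u % a ≟ v % a)
  samePart-% u v with u % a ≟ v % a
  ... | yes eq = trans
    (dec-true (_ Fin.≟ _) (toℕ-injective (trans (toℕ-mod u) (trans eq (sym (toℕ-mod v))))))
    (sym (dec-true (u % a ≟ v % a) eq))
  ... | no neq = trans
    (dec-false (_ Fin.≟ _) λ eq →
      neq (trans (sym (toℕ-mod u)) (trans (cong toℕ eq) (toℕ-mod v))))
    (sym (dec-false (u % a ≟ v % a) neq))

  t-sumTo : ∀ n → t n a ≡ sumTo (λ v → sumTo (λ u → ⟦ not (samePart u v) ⟧) v) n
  t-sumTo n = size-sumTo (turán n a) (λ u v → not (samePart u v)) (λ _ _ → refl)

  -- The vertices before `n` that are not adjacent to `n` are those of its part, and there are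
  -- `n / a` of them.
  turán-row : ∀ n → sumTo (λ u → ⟦ not (samePart u n) ⟧) n ≡ n ∸ n / a
  turán-row n = begin
    sumTo f n                          ≡⟨ sym (m+n∸n≡m (sumTo f n) (n / a)) ⟩
    sumTo f n + n / a ∸ n / a          ≡⟨ cong (λ x → sumTo f n + x ∸ n / a) (sym same) ⟩
    sumTo f n + sumTo g n ∸ n / a      ≡⟨ cong (_∸ n / a) (sym (sumTo-distrib-+ f g n)) ⟩
    sumTo (λ u → f u + g u) n ∸ n / a  ≡⟨ cong (_∸ n / a) (sumTo-cong n (λ u _ → one u)) ⟩
    sumTo (λ _ → 1) n ∸ n / a          ≡⟨ cong (_∸ n / a) (trans (sumTo-const 1 n) (*-identityʳ n)) ⟩
    n ∸ n / a                          ∎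
    where
    open ≡-Reasoning
    f g : ℕ → ℕ
    f u = ⟦ not (samePart u n) ⟧
    g u = ⟦ samePart u n ⟧
    one : ∀ u → f u + g u ≡ 1
    one u = trans (+-comm (f u) (g u)) (⟦b⟧+⟦¬b⟧≡1 (samePart u n))
    same : sumTo g n ≡ n / a
    same = begin
      sumTo g n
        ≡⟨ sumTo-cong n (λ u _ → cong ⟦_⟧ (samePart-% u n)) ⟩
      sumTo (λ u → ⟦ does (u % a ≟ n % a) ⟧) n
        ≡⟨ cong (sumTo (λ u → ⟦ does (u % a ≟ n % a) ⟧))
             (trans (m≡m%n+[m/n]*n n a) (+-comm (n % a) _)) ⟩
      sumTo (λ u → ⟦ does (u % a ≟ n % a) ⟧) (n / a * a + n % a)
        ≡⟨ count-residue (m%n<n n a) (n / a) ⟩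
      n / a ∎

  t-suc : ∀ n → t (suc n) a ≡ t n a + (n ∸ n / a)
  t-suc n = trans (t-sumTo (suc n)) (cong₂ _+_ (sym (t-sumTo n)) (turán-row n))

  2t-suc : ∀ n → t (suc n) a + t (suc n) a ≡ (t n a + t n a) + ((n ∸ n / a) + (n ∸ n / a))
  2t-suc n = trans (cong (λ x → x + x) (t-suc n))
    (+-interchange (t n a) (n ∸ n / a) (t n a) (n ∸ n / a))

  -- Degree sums do not refer to the order of the vertices, which makes the deletion of an arbitrary
  -- vertex easy to account for. By `handshake` they are twice the size.
  turán-bound : ∀ {n} (G : Graph n) → CliqueFree (suc a) G → degreeSum G ≤ t n a + t n a
  turán-bound {zero}  G free = z≤n
  turán-bound {suc n} G free with v , deg≤ ← lowDegreeVertex G free = begin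
    degreeSum G
      ≡⟨ degreeSum-ᵛ G v ⟩
    degreeSum (G -ᵛ v) + (degree G v + degree G v)
      ≤⟨ +-mono-≤ (turán-bound (G -ᵛ v) (-ᵛ-cliqueFree G v free)) (+-mono-≤ deg≤ deg≤) ⟩
    t n a + t n a + ((n ∸ n / a) + (n ∸ n / a))
      ≡⟨ sym (2t-suc n) ⟩
    t (suc n) a + t (suc n) a ∎
    where open ≤-Reasoning

  -- The equality case of Turán's theorem

  IsColouring : ∀ {n} → Graph n → (Fin n → Fin a) → Set
  IsColouring G c = ∀ u v → Adj G u v → c u ≢ c v

  colouring⇒cliqueFree : ∀ {n} {G : Graph n} {c} → IsColouring G c → CliqueFree (suc a) G
  colouring⇒cliqueFree {c = c} proper K clique
    with i , j , i<j , eq ← pigeonhole ≤-refl (c ∘ K) =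
    proper (K i) (K j) (clique i j (<⇒≢ i<j ∘ cong toℕ)) eq

  completeMultipartite-adj⁺ : ∀ {n} (c : Fin n → Fin a) {u v} → c u ≢ c v →
    Graph.adj (completeMultipartite c) u v ≡ true
  completeMultipartite-adj⁺ c c≢ = cong not (dec-false (_ Fin.≟ _) c≢)

  completeMultipartite-colouring : ∀ {n} (c : Fin n → Fin a) → IsColouring (completeMultipartite c) c
  completeMultipartite-colouring c u v u~v eq =
    subst T (cong not (dec-true (c u Fin.≟ c v) eq)) u~v

  -- G is contained in the complete multipartite graph of its colour classes, which is bound
  -- by Turán's theorem as well.
  extremal⇒completeMultipartite : ∀ {n} {G : Graph n} {c} → t n a + t n a ≤ degreeSum G →
    IsColouring G c → ∀ u v → c u ≢ c v → Adj G u v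
  extremal⇒completeMultipartite {n} {G} {c} 2t≤ proper u v c≢ =
    1≤⇒T (≤-trans (≤-reflexive (cong ⟦_⟧ (sym (completeMultipartite-adj⁺ c c≢))))
      (sum-mono-≤-tight (adj≤ u)
        (sum-mono-≤-tight (λ u → sum-mono-≤ (adj≤ u)) degreeSum≤ u) v))
    where
    M = completeMultipartite c
    degreeSum≤ : degreeSum M ≤ degreeSum G
    degreeSum≤ = ≤-trans
      (turán-bound M (colouring⇒cliqueFree {G = M} {c} (completeMultipartite-colouring c))) 2t≤
    adj≤ : ∀ u v → ⟦ Graph.adj G u v ⟧ ≤ ⟦ Graph.adj M u v ⟧
    adj≤ u v with Graph.adj G u v in eq
    ... | false = z≤n
    ... | true  = ≤-reflexive (cong ⟦_⟧ (sym
      (completeMultipartite-adj⁺ c (proper u v (subst T (sym eq) tt)))))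
    1≤⇒T : ∀ {b} → 1 ≤ ⟦ b ⟧ → T b
    1≤⇒T {true} _ = tt

  insertColour : ∀ {n} (G : Graph (suc n)) v p {c} → IsColouring (G -ᵛ v) c →
    (∀ x → Adj G v (punchIn v x) → c x ≢ p) → IsColouring G (insertAt c v p)
  insertColour G v p {c} proper v≁p u w u~w with ≡-or-punchIn v u | ≡-or-punchIn v w
  ... | inj₁ refl       | inj₁ refl       = contradiction u~w (Adj-irrefl G)
  ... | inj₁ refl       | inj₂ (y , refl)
    rewrite insertAt-lookup c v p | insertAt-punchIn c v p y = v≁p y u~w ∘ sym
  ... | inj₂ (x , refl) | inj₁ refl
    rewrite insertAt-lookup c v p | insertAt-punchIn c v p x = v≁p x (Adj-sym G u~w)
  ... | inj₂ (x , refl) | inj₂ (y , refl)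
    rewrite insertAt-punchIn c v p x | insertAt-punchIn c v p y = proper x y u~w

  -- The deletion costs `G` at most as much as the step from `suc n` to `n` costs the Turán graph,
  -- so extremality is inherited.
  extremal-ᵛ : ∀ {n} (G : Graph (suc n)) {v} → degree G v ≤ n ∸ n / a →
    t (suc n) a + t (suc n) a ≤ degreeSum G → t n a + t n a ≤ degreeSum (G -ᵛ v)
  extremal-ᵛ {n} G {v} deg≤ 2t≤ = +-cancelʳ-≤ ((n ∸ n / a) + (n ∸ n / a)) _ _ (begin
    t n a + t n a + ((n ∸ n / a) + (n ∸ n / a))       ≡⟨ sym (2t-suc n) ⟩
    t (suc n) a + t (suc n) a                         ≤⟨ 2t≤ ⟩
    degreeSum G                                       ≡⟨ degreeSum-ᵛ G v ⟩
    degreeSum (G -ᵛ v) + (degree G v + degree G v)    ≤⟨ +-monoʳ-≤ (degreeSum (G -ᵛ v)) (+-mono-≤ deg≤ deg≤) ⟩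
    degreeSum (G -ᵛ v) + ((n ∸ n / a) + (n ∸ n / a))  ∎)
    where open ≤-Reasoning

  -- Without a vertex of low degree the graph is still extremal, hence coloured by induction and
  -- complete multipartite. A colour class that contains no neighbour of the deleted vertex can take
  -- it in.
  extremal⇒colourable : ∀ {n} (G : Graph n) → CliqueFree (suc a) G →
    t n a + t n a ≤ degreeSum G → ∃[ c ] IsColouring G c
  extremal⇒colourable {zero}  G free 2t≤ = (λ ()) , (λ ())
  extremal⇒colourable {suc n} G free 2t≤ with v , deg≤ ← lowDegreeVertex G free = recolour
    where
    2t≤′ : t n a + t n a ≤ degreeSum (G -ᵛ v)
    2t≤′ = extremal-ᵛ G deg≤ 2t≤

    recolour : ∃[ c ] IsColouring G c
    recolour
      with c , proper ← extremal⇒colourable (G -ᵛ v) (-ᵛ-cliqueFree G v free) 2t≤′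
      with neighbourIn? ← (λ p → any? (λ x → (c x Fin.≟ p) ×-dec T? (Graph.adj G v (punchIn v x))))
      with all? neighbourIn?
    ... | no ¬nbr with p , ∄x ← ¬∀⟶∃¬ a _ neighbourIn? ¬nbr =
      insertAt c v p , insertColour G v p proper (λ x v~x eq → ∄x (x , eq , v~x))
    -- v together with one neighbour in every colour class is a clique.
    ... | yes nbr = contradiction (clique-∷ G (proj₂ ∘ proj₂ ∘ nbr) transversal) (free _)
      where
      transversal : IsClique G (λ p → punchIn v (proj₁ (nbr p)))
      transversal p q p≢q = extremal⇒completeMultipartite {G = G -ᵛ v} 2t≤′ proper _ _ λ eq → p≢q
        (trans (sym (proj₁ (proj₂ (nbr p)))) (trans eq (proj₁ (proj₂ (nbr q)))))

-- Monophonic position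

injective⇒≤∣∣ : ∀ {k n} {f : Fin k → Fin n} {S} → Injective _≡_ _≡_ f →
  (∀ i → f i ∈ S) → k ≤ ∣ S ∣
injective⇒≤∣∣ {zero}      inj f∈S = z≤n
injective⇒≤∣∣ {suc k} {f = f} {S} inj f∈S = ≤-trans
  (s≤s (injective⇒≤∣∣ {f = f ∘ suc} {S - f zero} (Fin.suc-injective ∘ inj)
    (λ i → x∈p∧x≢y⇒x∈p-y (f∈S (suc i)) (λ eq → contradiction (inj eq) λ ()))))
  (x∈p⇒∣p-x∣<∣p∣ (f∈S zero))

element : ∀ {n} (S : Subset n) → Fin ∣ S ∣ → Fin n
element (inside  Vec.∷ S) zero    = zero
element (inside  Vec.∷ S) (suc i) = suc (element S i)
element (outside Vec.∷ S) i       = suc (element S i)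

element-∈ : ∀ {n} (S : Subset n) i → element S i ∈ S
element-∈ (inside  Vec.∷ S) zero    = here
element-∈ (inside  Vec.∷ S) (suc i) = there (element-∈ S i)
element-∈ (outside Vec.∷ S) i       = there (element-∈ S i)

element-injective : ∀ {n} (S : Subset n) → Injective _≡_ _≡_ (element S)
element-injective (inside  Vec.∷ S) {zero}  {zero}  eq = refl
element-injective (inside  Vec.∷ S) {suc i} {suc j} eq =
  cong suc (element-injective S (Fin.suc-injective eq))
element-injective (outside Vec.∷ S) eq = element-injective S (Fin.suc-injective eq)

threeElements : ∀ {n} (S : Subset n) → 3 ≤ ∣ S ∣ → ∃[ x ] ∃[ y ] ∃[ z ]
  (x ∈ S × y ∈ S × z ∈ S) × (x ≢ y × y ≢ z × x ≢ z)
threeElements S 3≤ = e 0F , e 1F , e 2F , (∈S 0F , ∈S 1F , ∈S 2F) ,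
  ((λ ()) ∘ inj , (λ ()) ∘ inj , (λ ()) ∘ inj)
  where
  e : Fin 3 → Fin _
  e i = element S (Fin.inject≤ i 3≤)
  ∈S : ∀ i → e i ∈ S
  ∈S i = element-∈ S (Fin.inject≤ i 3≤)
  inj : ∀ {i j} → e i ≡ e j → i ≡ j
  inj eq = Fin.inject≤-injective 3≤ 3≤ _ _ (element-injective S eq)

module _ {n : ℕ} where

  -- Has the form of `MonophonicPath.vertices`, so that the vertex set of a path `P` is
  -- `image (vertex P)` by definition.
  image : ∀ {k} → (Fin k → Fin n) → Subset n
  image f = ⋃ (List.tabulate λ i → ⁅ f i ⁆)

  ∈-image⁺ : ∀ {k} (f : Fin k → Fin n) i → f i ∈ image f
  ∈-image⁺ f zero    = x∈p∪q⁺ (inj₁ (x∈⁅x⁆ (f zero)))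
  ∈-image⁺ f (suc i) = x∈p∪q⁺ (inj₂ (∈-image⁺ (f ∘ suc) i))

  ∈-image⁻ : ∀ {k} (f : Fin k → Fin n) {x} → x ∈ image f → ∃[ i ] f i ≡ x
  ∈-image⁻ {zero}  f x∈ = contradiction x∈ ∉⊥
  ∈-image⁻ {suc k} f x∈ with x∈p∪q⁻ ⁅ f zero ⁆ (image (f ∘ suc)) x∈
  ... | inj₁ x∈⁅⁆ = zero , sym (x∈⁅y⁆⇒x≡y _ x∈⁅⁆)
  ... | inj₂ x∈im with i , eq ← ∈-image⁻ (f ∘ suc) x∈im = suc i , eq

  ∈-tabulate⁻ : ∀ {f : Fin n → Bool} {x} → x ∈ Vec.tabulate f → f x ≡ true
  ∈-tabulate⁻ {f} {x} x∈ = trans (sym (lookup∘tabulate f x)) ([]=⇒lookup x∈)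

  ∈-partiteSet⁻ : ∀ {a} (c : Fin n → Fin a) {p x} → x ∈ partiteSet c p → c x ≡ p
  ∈-partiteSet⁻ c {p} {x} x∈ with c x Fin.≟ p | ∈-tabulate⁻ {λ v → does (c v Fin.≟ p)} x∈
  ... | yes eq | _ = eq

∣tabulate∣ : ∀ {n} (f : Fin n → Bool) → ∣ Vec.tabulate f ∣ ≡ ∑[ i < n ] ⟦ f i ⟧
∣tabulate∣ {zero}  f = refl
∣tabulate∣ {suc n} f with f zero
... | true  = cong suc (∣tabulate∣ (f ∘ suc))
... | false = ∣tabulate∣ (f ∘ suc)

a²+1≤n⇒a*a<n : ∀ {a n} → n ≥ a ^ 2 + 1 → a * a < n
a²+1≤n⇒a*a<n {a} = ≤-trans (≤-reflexive
  (trans (cong (λ x → suc (a * x)) (sym (*-identityʳ a))) (+-comm 1 (a ^ 2))))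

-- Double counting of the pairs of a vertex and its part: parts of at most `m` vertices would hold
-- at most `a * m` vertices.
largePart : ∀ {n a m} (c : Fin n → Fin a) → a * m < n → ∃[ p ] m < ∣ partiteSet c p ∣
largePart {n} {a} {m} c am<n with any? (λ p → m <? ∣ partiteSet c p ∣)
... | yes p = p
... | no ∄p = contradiction am<n (≤⇒≯ (begin
  n
    ≤⟨ n≤sum (λ v → ≤-trans
         (≤-reflexive (cong ⟦_⟧ (sym (dec-true (c v Fin.≟ c v) refl))))
         (fᵢ≤sum (λ p → ⟦ does (c v Fin.≟ p) ⟧) (c v))) ⟩
  ∑[ v < n ] ∑[ p < a ] ⟦ does (c v Fin.≟ p) ⟧
    ≡⟨ ∑-comm {n} {a} (λ v p → ⟦ does (c v Fin.≟ p) ⟧) ⟩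
  ∑[ p < a ] ∑[ v < n ] ⟦ does (c v Fin.≟ p) ⟧
    ≤⟨ sum-≤-* m (λ p → ≤-trans
         (≤-reflexive (sym (∣tabulate∣ (λ v → does (c v Fin.≟ p)))))
         (≮⇒≥ (λ m<∣p∣ → ∄p (p , m<∣p∣)))) ⟩
  a * m ∎))
  where open ≤-Reasoning

sort₃ : ∀ {k} {Q : Fin k → Set} {i j l} → Q i → Q j → Q l → i ≢ j → j ≢ l → i ≢ l →
  ∃[ x ] ∃[ y ] ∃[ z ] (x Fin.< y × y Fin.< z) × (Q x × Q y × Q z)
sort₃ {i = i} {j} {l} Qi Qj Ql i≢j j≢l i≢l with Fin.<-cmp i j | Fin.<-cmp j l | Fin.<-cmp i l
... | tri≈ _ i≡j _ | _            | _            = contradiction i≡j i≢j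
... | _            | tri≈ _ j≡l _ | _            = contradiction j≡l j≢l
... | _            | _            | tri≈ _ i≡l _ = contradiction i≡l i≢l
... | tri< i<j _ _ | tri< j<l _ _ | _            = _ , _ , _ , (i<j , j<l) , (Qi , Qj , Ql)
... | tri< i<j _ _ | tri> _ _ l<j | tri< i<l _ _ = _ , _ , _ , (i<l , l<j) , (Qi , Ql , Qj)
... | tri< i<j _ _ | tri> _ _ l<j | tri> _ _ l<i = _ , _ , _ , (l<i , i<j) , (Ql , Qi , Qj)
... | tri> _ _ j<i | tri< j<l _ _ | tri< i<l _ _ = _ , _ , _ , (j<i , i<l) , (Qj , Qi , Ql)
... | tri> _ _ j<i | tri< j<l _ _ | tri> _ _ l<i = _ , _ , _ , (j<l , l<i) , (Qj , Ql , Qi)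
... | tri> _ _ j<i | tri> _ _ l<j | _            = _ , _ , _ , (l<j , j<i) , (Ql , Qj , Qi)

module _ {n} (G : Graph n) where
  open MonophonicPath

  -- Three elements of `S` on a path occupy three positions, and sorting these leaves only
  -- increasing triples to be refuted.
  monophonicPosition⁺ : ∀ {S} →
    (∀ {k} (P : MonophonicPath G k) i j l → i Fin.< j → j Fin.< l →
      vertex P i ∈ S → vertex P j ∈ S → vertex P l ∈ S → ⊥) →
    InMonophonicPosition G S
  monophonicPosition⁺ {S} noThree P = ≮⇒≥ λ 3≤ →
    let x , y , z , (x∈ , y∈ , z∈) , (x≢y , y≢z , x≢z) = threeElements (S ∩ vertices P) 3≤
        x∈S , x∈P = x∈p∩q⁻ S _ x∈
        y∈S , y∈P = x∈p∩q⁻ S _ y∈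
        z∈S , z∈P = x∈p∩q⁻ S _ z∈
        i , i↦x = ∈-image⁻ (vertex P) x∈P
        j , j↦y = ∈-image⁻ (vertex P) y∈P
        l , l↦z = ∈-image⁻ (vertex P) z∈P
        _ , _ , _ , (<₁ , <₂) , (∈₁ , ∈₂ , ∈₃) = sort₃ {Q = λ i → vertex P i ∈ S}
          (subst (_∈ S) (sym i↦x) x∈S) (subst (_∈ S) (sym j↦y) y∈S) (subst (_∈ S) (sym l↦z) z∈S)
          (λ eq → x≢y (trans (sym i↦x) (trans (cong (vertex P) eq) j↦y)))
          (λ eq → y≢z (trans (sym j↦y) (trans (cong (vertex P) eq) l↦z)))
          (λ eq → x≢z (trans (sym i↦x) (trans (cong (vertex P) eq) l↦z)))
    in  noThree P _ _ _ <₁ <₂ ∈₁ ∈₂ ∈₃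

  -- The first and the last of three clique vertices on a path are adjacent, yet at least two steps
  -- apart: they form a chord.
  clique-monophonicPosition : ∀ {k} {K : Fin k → Fin n} → IsClique G K →
    InMonophonicPosition G (image K)
  clique-monophonicPosition {K = K} clique = monophonicPosition⁺ λ P i j l i<j j<l i∈ _ l∈ →
    let r , Kr≡ = ∈-image⁻ K i∈
        s , Ks≡ = ∈-image⁻ K l∈
        i≢l     = λ i≡l → <-irrefl (cong toℕ i≡l) (<-trans i<j j<l)
        r≢s     = λ r≡s → i≢l (distinct P (trans (sym Kr≡) (trans (cong K r≡s) Ks≡)))
    in  chordless P i l (≤-trans (s≤s i<j) j<l) (subst₂ (Adj G) Kr≡ Ks≡ (clique r s r≢s))

  clique⇒≤∣image∣ : ∀ {k} {K : Fin k → Fin n} → IsClique G K → k ≤ ∣ image K ∣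
  clique⇒≤∣image∣ {K = K} clique = injective⇒≤∣∣ {f = K} injective (∈-image⁺ K)
    where
    injective : Injective _≡_ _≡_ K
    injective {i} {j} Ki≡Kj with i Fin.≟ j
    ... | yes i≡j = i≡j
    ... | no  i≢j = contradiction (subst (Adj G _) (sym Ki≡Kj) (clique i j i≢j)) (Adj-irrefl G)

  -- The successor `i⁺` of `i` on the path lies outside the part, so it comes strictly before `j`.
  -- It is adjacent to every vertex of the part, in particular to the one at `l`, and this edge is a
  -- chord.
  part-monophonicPosition : ∀ {a} {c : Fin n → Fin a} →
    (∀ u v → Adj G u v → c u ≢ c v) → (∀ u v → c u ≢ c v → Adj G u v) →
    ∀ p → InMonophonicPosition G (partiteSet c p)
  part-monophonicPosition {c = c} proper complete p = monophonicPosition⁺ noThree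
    where
    noThree : ∀ {k} (P : MonophonicPath G k) i j l → i Fin.< j → j Fin.< l →
      vertex P i ∈ partiteSet c p → vertex P j ∈ partiteSet c p → vertex P l ∈ partiteSet c p → ⊥
    noThree P i j l i<j j<l i∈ j∈ l∈ =
      chordless P i⁺ l (≤-trans (s≤s i⁺<j) j<l) (complete _ _ (c≢p ∘ λ eq → trans eq (∈-partiteSet⁻ c l∈)))
      where
      i⁺ = Fin.fromℕ< (≤-<-trans i<j (toℕ<n j))
      i⁺≡ : toℕ i⁺ ≡ suc (toℕ i)
      i⁺≡ = toℕ-fromℕ< (≤-<-trans i<j (toℕ<n j))
      c≢p : c (vertex P i⁺) ≢ p
      c≢p eq = proper _ _ (path P i i⁺ i⁺≡) (trans (∈-partiteSet⁻ c i∈) (sym eq))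
      i⁺<j : i⁺ Fin.< j
      i⁺<j = ≤∧≢⇒< (≤-trans (≤-reflexive i⁺≡) i<j)
        (λ eq → c≢p (trans (cong (c ∘ vertex P) (toℕ-injective eq)) (∈-partiteSet⁻ c j∈)))

  mpNumber⇒cliqueFree : ∀ {a} → IsMpNumber G a → CliqueFree (suc a) G
  mpNumber⇒cliqueFree (_ , maximal) K clique = <⇒≱ (clique⇒≤∣image∣ clique)
    (maximal _ (image K , clique-monophonicPosition clique , refl))

  mpNumber⇒size<t : ∀ {a} .{{_ : NonZero a}} → n ≥ a ^ 2 + 1 → IsMpNumber G a → size G < t n a
  mpNumber⇒size<t {a} n≥ mp@(_ , maximal) = ≰⇒> λ t≤size →
    let 2t≤       = ≤-trans (+-mono-≤ t≤size t≤size) (≤-reflexive (sym (handshake G)))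
        c , proper = extremal⇒colourable a G (mpNumber⇒cliqueFree mp) 2t≤
        complete  = extremal⇒completeMultipartite a {G = G} {c} 2t≤ proper
        p , a<∣p∣ = largePart {m = a} c (a²+1≤n⇒a*a<n {a} n≥)
    in  <⇒≱ a<∣p∣ (maximal _ (partiteSet c p , part-monophonicPosition proper complete p , refl))

-- The Turán graph without the edges inside full rows

does⁺ : ∀ {A : Set} (A? : Dec A) → A → T (does A?)
does⁺ A? x = subst T (sym (dec-true A? x)) tt

does⁻ : ∀ {A : Set} (A? : Dec A) → T (does A?) → A
does⁻ (yes x) _ = x

≢-third : ∀ {m} → 3 ≤ m → ∀ i j → ∃[ l ] l < m × l ≢ i × l ≢ j
≢-third 3≤m 0             0             = 1 , <-≤-trans (s≤s (s≤s z≤n)) 3≤m , (λ ()) , (λ ())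
≢-third 3≤m 0             1             = 2 , 3≤m , (λ ()) , (λ ())
≢-third 3≤m 0             (suc (suc _)) = 1 , <-≤-trans (s≤s (s≤s z≤n)) 3≤m , (λ ()) , (λ ())
≢-third 3≤m 1             0             = 2 , 3≤m , (λ ()) , (λ ())
≢-third 3≤m (suc (suc _)) 0             = 1 , <-≤-trans (s≤s (s≤s z≤n)) 3≤m , (λ ()) , (λ ())
≢-third 3≤m (suc _)       (suc _)       = 0 , <-≤-trans (s≤s z≤n) 3≤m , (λ ()) , (λ ())

≢-other : ∀ {m} → 2 ≤ m → ∀ i → ∃[ l ] l < m × l ≢ i
≢-other 2≤m zero    = 1 , 2≤m , (λ ())
≢-other 2≤m (suc _) = 0 , <-≤-trans (s≤s z≤n) 2≤m , (λ ())

-- Building induced paths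

module _ {n} (G : Graph n) where
  open MonophonicPath

  Apart : Fin n → Fin n → Set
  Apart u v = u ≢ v × ¬ Adj G u v

  singletonPath : Fin n → MonophonicPath G 1
  singletonPath u = record
    { vertex    = λ _ → u
    ; distinct  = λ { {0F} {0F} _ → refl }
    ; path      = λ { 0F 0F () }
    ; chordless = λ { 0F 0F () }
    }

  consPath : ∀ {k} u (P : MonophonicPath G (suc k)) → Adj G u (vertex P zero) →
    (∀ i → Apart u (vertex P (suc i))) → MonophonicPath G (suc (suc k))
  consPath {k} u P u~ apart = record
    { vertex    = u Vector.∷ vertex P
    ; distinct  = distinct′ _ _
    ; path      = path′
    ; chordless = chordless′
    }
    where
    w : Fin (suc (suc k)) → Fin n
    w = u Vector.∷ vertex P

    u≢ : ∀ i → u ≢ vertex P i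
    u≢ zero    refl = Adj-irrefl G u~
    u≢ (suc i) = proj₁ (apart i)

    distinct′ : ∀ i j → w i ≡ w j → i ≡ j
    distinct′ zero    zero    eq = refl
    distinct′ zero    (suc j) eq = contradiction eq (u≢ j)
    distinct′ (suc i) zero    eq = contradiction (sym eq) (u≢ i)
    distinct′ (suc i) (suc j) eq = cong suc (distinct P eq)

    path′ : ∀ i j → toℕ j ≡ suc (toℕ i) → Adj G (w i) (w j)
    path′ zero    (suc zero) eq = u~
    path′ (suc i) (suc j)    eq = path P i j (suc-injective eq)

    chordless′ : ∀ i j → suc (toℕ i) < toℕ j → ¬ Adj G (w i) (w j)
    chordless′ zero    (suc (suc j)) lt = proj₂ (apart j)
    chordless′ zero    (suc zero)    (s≤s ())
    chordless′ (suc i) (suc j)       lt = chordless P i j (≤-pred lt)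

  -- The order of the three vertices along the path is left open, so the relation is symmetric;
  -- `OnPath-rotate` and `OnPath-swap` generate all permutations.
  OnPath : Fin n → Fin n → Fin n → Set
  OnPath x y z = ∃[ k ] Σ[ P ∈ MonophonicPath G k ] ∃[ i ] ∃[ j ] ∃[ l ]
    vertex P i ≡ x × vertex P j ≡ y × vertex P l ≡ z

  OnPath-rotate : ∀ {x y z} → OnPath x y z → OnPath y z x
  OnPath-rotate (_ , P , i , j , l , eqˣ , eqʸ , eqᶻ) = _ , P , j , l , i , eqʸ , eqᶻ , eqˣ

  OnPath-swap : ∀ {x y z} → OnPath x y z → OnPath y x z
  OnPath-swap (_ , P , i , j , l , eqˣ , eqʸ , eqᶻ) = _ , P , j , i , l , eqʸ , eqˣ , eqᶻ

  onPath⇒¬monophonicPosition : ∀ {S x y z} → x ≢ y → y ≢ z → x ≢ z →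
    x ∈ S → y ∈ S → z ∈ S → OnPath x y z → ¬ InMonophonicPosition G S
  onPath⇒¬monophonicPosition {S} {x} {y} {z} x≢y y≢z x≢z x∈ y∈ z∈
    (_ , P , i , j , l , i↦x , j↦y , l↦z) mono =
    <⇒≱ (injective⇒≤∣∣ {f = f} (λ {i} {j} → injective i j) f∈) (mono P)
    where
    f : Fin 3 → Fin n
    f 0F = x
    f 1F = y
    f 2F = z
    injective : ∀ i j → f i ≡ f j → i ≡ j
    injective 0F 0F eq = refl
    injective 0F 1F eq = contradiction eq x≢y
    injective 0F 2F eq = contradiction eq x≢z
    injective 1F 0F eq = contradiction (sym eq) x≢y
    injective 1F 1F eq = refl
    injective 1F 2F eq = contradiction eq y≢z
    injective 2F 0F eq = contradiction (sym eq) x≢z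
    injective 2F 1F eq = contradiction (sym eq) y≢z
    injective 2F 2F eq = refl
    f∈ : ∀ i → f i ∈ S ∩ vertices P
    f∈ 0F = x∈p∩q⁺ (x∈ , subst (_∈ vertices P) i↦x (∈-image⁺ (vertex P) i))
    f∈ 1F = x∈p∩q⁺ (y∈ , subst (_∈ vertices P) j↦y (∈-image⁺ (vertex P) j))
    f∈ 2F = x∈p∩q⁺ (z∈ , subst (_∈ vertices P) l↦z (∈-image⁺ (vertex P) l))

module _ (n a : ℕ) .{{_ : NonZero a}} where

  -- The vertices are laid out in rows of length a, so that the columns are the parts of the
  -- Turán graph; the edges inside each of the n / a full rows are removed.
  ThinnedEdge : ℕ → ℕ → Set
  ThinnedEdge u v = u % a ≢ v % a × (u / a ≡ v / a → n / a ≤ u / a)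

  thinnedEdge? : ∀ u v → Dec (ThinnedEdge u v)
  thinnedEdge? u v = ¬? (u % a ≟ v % a) ×-dec ((u / a ≟ v / a) →-dec (n / a ≤? u / a))

  thinnedEdge-sym : ∀ {u v} → ThinnedEdge u v → ThinnedEdge v u
  thinnedEdge-sym (u≢v , r≤) =
    u≢v ∘ sym , λ eq → subst (n / a ≤_) (sym eq) (r≤ (sym eq))

  thinnedTurán : Graph n
  thinnedTurán = record
    { adj        = λ u v → does (thinnedEdge? (toℕ u) (toℕ v))
    ; adj-sym    = λ u v → does-⇔ (mk⇔ thinnedEdge-sym thinnedEdge-sym)
                     (thinnedEdge? (toℕ u) (toℕ v)) (thinnedEdge? (toℕ v) (toℕ u))
    ; adj-irrefl = λ v → dec-false (thinnedEdge? (toℕ v) (toℕ v)) λ (≢ , _) → ≢ refl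
    }

-- The number of removed edges

sumTo-id : ∀ n → sumTo id n ≡ n C 2
sumTo-id zero    = refl
sumTo-id (suc n) = begin
  sumTo id n + n  ≡⟨ cong₂ _+_ (sumTo-id n) (sym (nC1≡n n)) ⟩
  n C 2 + n C 1   ≡⟨ +-comm (n C 2) (n C 1) ⟩
  n C 1 + n C 2   ≡⟨ nCk+nC[k+1]≡[n+1]C[k+1] n 1 ⟩
  suc n C 2       ∎
  where open ≡-Reasoning

module _ (a : ℕ) .{{_ : NonZero a}} where

  -- Each of the `r` rows contributes 0 + 1 + ... + (a - 1), the number of pairs in a row.
  sumTo-% : ∀ r → sumTo (_% a) (r * a) ≡ r * (a C 2)
  sumTo-% zero    = refl
  sumTo-% (suc r) = begin
    sumTo (_% a) (a + r * a)
      ≡⟨ sumTo-+ (_% a) a (r * a) ⟩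
    sumTo (_% a) a + sumTo (λ i → (a + i) % a) (r * a)
      ≡⟨ cong₂ _+_
           (trans (sumTo-cong a (λ i i<a → m<n⇒m%n≡m i<a)) (sumTo-id a))
           (trans (sumTo-cong (r * a) (λ i _ →
              [n+m]%n≡m%n a i)) (sumTo-% r)) ⟩
    suc r * (a C 2) ∎
    where open ≡-Reasoning

  -- The row of `v` starts at `v / a * a`; all smaller numbers belong to earlier rows, and `v % a`
  -- numbers remain before `v`.
  sumTo-sameRow : ∀ v → sumTo (λ u → ⟦ does (u / a ≟ v / a) ⟧) v ≤ v % a
  sumTo-sameRow v = begin
    sumTo f v
      ≡⟨ cong (sumTo f) (trans (m≡m%n+[m/n]*n v a) (+-comm (v % a) _)) ⟩
    sumTo f (v / a * a + v % a)
      ≡⟨ sumTo-+ f (v / a * a) (v % a) ⟩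
    sumTo f (v / a * a) + sumTo (λ i → f (v / a * a + i)) (v % a)
      ≡⟨ cong (_+ sumTo (λ i → f (v / a * a + i)) (v % a))
           (sumTo-zero (v / a * a) λ u u< →
              cong ⟦_⟧ (dec-false (u / a ≟ v / a) (<⇒≢ (m<n*o⇒m/o<n u<)))) ⟩
    sumTo (λ i → f (v / a * a + i)) (v % a)
      ≤⟨ sumTo-mono-≤ (v % a) (λ _ _ → ⟦b⟧≤1 _) ⟩
    sumTo (λ _ → 1) (v % a)
      ≡⟨ trans (sumTo-const 1 (v % a)) (*-identityʳ (v % a)) ⟩
    v % a ∎
    where
    open ≤-Reasoning
    f : ℕ → ℕ
    f u = ⟦ does (u / a ≟ v / a) ⟧

  -- An edge of the Turán graph either survives or joins two vertices of one full row. The pairs of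
  -- the second kind are `lost`, and they are counted at their larger end.
  t≤size-thinnedTurán : ∀ n → t n a ≤ size (thinnedTurán n a) + n / a * (a C 2)
  t≤size-thinnedTurán n = begin
    t n a
      ≡⟨ t-sumTo a n ⟩
    sumTo (λ v → sumTo (λ u → ⟦ not (samePart a u v) ⟧) v) n
      ≤⟨ sumTo-mono-≤ n (λ v _ → ≤-trans (sumTo-mono-≤ v (λ u _ → split u v))
           (≤-reflexive (sumTo-distrib-+ (λ u → edge u v) (λ u → lost u v) v))) ⟩
    sumTo (λ v → sumTo (λ u → edge u v) v + sumTo (λ u → lost u v) v) n
      ≡⟨ sumTo-distrib-+ (λ v → sumTo (λ u → edge u v) v) (λ v → sumTo (λ u → lost u v) v) n ⟩
    sumTo (λ v → sumTo (λ u → edge u v) v) n + sumTo (λ v → sumTo (λ u → lost u v) v) n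
      ≤⟨ +-mono-≤
           (≤-reflexive (sym (size-sumTo (thinnedTurán n a)
             (λ u v → does (thinnedEdge? n a u v)) (λ _ _ → refl))))
           totalLost ⟩
    size (thinnedTurán n a) + n / a * (a C 2) ∎
    where
    open ≤-Reasoning
    edge lost : ℕ → ℕ → ℕ
    edge u v = ⟦ does (thinnedEdge? n a u v) ⟧
    lost u v = ⟦ does (v / a <? n / a) ∧ does (u / a ≟ v / a) ⟧

    split : ∀ u v → ⟦ not (samePart a u v) ⟧ ≤ edge u v + lost u v
    split u v with thinnedEdge? n a u v
    ... | yes uv = ≤-trans (⟦b⟧≤1 _) (≤-trans
      (≤-reflexive (cong ⟦_⟧ (sym (dec-true (thinnedEdge? n a u v) uv)))) (m≤m+n _ _))
    ... | no ¬uv with u % a ≟ v % a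
    ... | yes u≡v = ≤-trans (≤-reflexive (cong (⟦_⟧ ∘ not)
      (trans (samePart-% a u v) (dec-true (u % a ≟ v % a) u≡v)))) z≤n
    ... | no  u≢v with u / a ≟ v / a
    ... | no  row≢ = contradiction (u≢v , λ row≡ → contradiction row≡ row≢) ¬uv
    ... | yes row≡ = ≤-trans (⟦b⟧≤1 _) (≤-trans
      (≤-reflexive (cong₂ (λ b c → ⟦ b ∧ c ⟧)
        (sym (dec-true (v / a <? n / a) (≰⇒> λ r≤ → ¬uv (u≢v , λ _ → subst (n / a ≤_) (sym row≡) r≤))))
        (sym (dec-true (u / a ≟ v / a) row≡))))
      (m≤n+m _ (edge u v)))

    totalLost : sumTo (λ v → sumTo (λ u → lost u v) v) n ≤ n / a * (a C 2)
    totalLost = begin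
      sumTo f n
        ≡⟨ cong (sumTo f) (trans (m≡m%n+[m/n]*n n a) (+-comm (n % a) _)) ⟩
      sumTo f (n / a * a + n % a)
        ≡⟨ sumTo-+ f (n / a * a) (n % a) ⟩
      sumTo f (n / a * a) + sumTo (λ i → f (n / a * a + i)) (n % a)
        -- The vertices after the full rows lose no edge.
        ≡⟨ cong (λ s → sumTo f (n / a * a) + s) (sumTo-zero (n % a) (λ i _ →
             sumTo-zero (n / a * a + i) (λ u _ → beyond u i))) ⟩
      sumTo f (n / a * a) + 0
        ≡⟨ +-identityʳ _ ⟩
      sumTo f (n / a * a)
        ≤⟨ sumTo-mono-≤ (n / a * a) (λ v _ →
             ≤-trans (sumTo-mono-≤ v (λ u _ → drop _ _)) (sumTo-sameRow v)) ⟩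
      sumTo (_% a) (n / a * a)
        ≡⟨ sumTo-% (n / a) ⟩
      n / a * (a C 2) ∎
      where
      f : ℕ → ℕ
      f v = sumTo (λ u → lost u v) v
      drop : ∀ b c → ⟦ b ∧ c ⟧ ≤ ⟦ c ⟧
      drop true  c = ≤-refl
      drop false c = z≤n
      beyond : ∀ u i → lost u (n / a * a + i) ≡ 0
      beyond u i = cong (λ b → ⟦ b ∧ does (u / a ≟ (n / a * a + i) / a) ⟧)
        (dec-false ((n / a * a + i) / a <? n / a) (≤⇒≯
          (≤-trans (≤-reflexive (sym (m*n/n≡m (n / a) a))) (/-monoˡ-≤ a (m≤m+n (n / a * a) i)))))

-- The mp-number of the thinned Turán graph

module ThinnedTurán (n a : ℕ) .{{_ : NonZero a}} (2≤a : 2 ≤ a) (n≥ : n ≥ a ^ 2 + 1) where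

  G : Graph n
  G = thinnedTurán n a

  r : ℕ
  r = n / a

  row col : Fin n → ℕ
  row v = toℕ v / a
  col v = toℕ v % a

  col< : ∀ v → col v < a
  col< v = m%n<n (toℕ v) a

  row≤ : ∀ v → row v ≤ r
  row≤ v = /-monoˡ-≤ a (<⇒≤ (toℕ<n v))

  a*a<n : a * a < n
  a*a<n = a²+1≤n⇒a*a<n {a} n≥

  a≤r : a ≤ r
  a≤r = ≤-trans (≤-reflexive (sym (m*n/n≡m a a))) (/-monoˡ-≤ a (<⇒≤ a*a<n))

  row-col-injective : ∀ {u v} → row u ≡ row v → col u ≡ col v → u ≡ v
  row-col-injective {u} {v} row≡ col≡ = toℕ-injective (begin
    toℕ u                 ≡⟨ m≡m%n+[m/n]*n (toℕ u) a ⟩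
    col u + row u * a     ≡⟨ cong₂ (λ p i → p + i * a) col≡ row≡ ⟩
    col v + row v * a     ≡⟨ sym (m≡m%n+[m/n]*n (toℕ v) a) ⟩
    toℕ v                 ∎)
    where open ≡-Reasoning

  vertexAt : ∀ i p → p < a → p + i * a < n → ∃[ v ] row v ≡ i × col v ≡ p
  vertexAt i p p<a <n = fromℕ< <n ,
    trans (cong (_/ a) (toℕ-fromℕ< <n))
      (trans (+-distrib-/-∣ʳ p (divides-refl i)) (cong₂ _+_ (m<n⇒m/n≡0 p<a) (m*n/n≡m i a))) ,
    trans (cong (_% a) (toℕ-fromℕ< <n)) (trans ([m+kn]%n≡m%n p i a) (m<n⇒m%n≡m p<a))

  fullRowVertex : ∀ {i p} → i < r → p < a → ∃[ v ] row v ≡ i × col v ≡ p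
  fullRowVertex {i} {p} i<r p<a = vertexAt i p p<a (begin-strict
    p + i * a    <⟨ +-monoˡ-< (i * a) p<a ⟩
    suc i * a    ≤⟨ *-monoˡ-≤ a i<r ⟩
    r * a        ≤⟨ m/n*n≤m n a ⟩
    n            ∎)
    where open ≤-Reasoning

  edge : ∀ {u v} → col u ≢ col v → (row u ≡ row v → r ≤ row u) → Adj G u v
  edge {u} {v} col≢ r≤ = does⁺ (thinnedEdge? n a (toℕ u) (toℕ v)) (col≢ , r≤)

  edge-row≢ : ∀ {u v} → col u ≢ col v → row u ≢ row v → Adj G u v
  edge-row≢ col≢ row≢ = edge col≢ (λ row≡ → contradiction row≡ row≢)

  apart-col : ∀ {u v} → col u ≡ col v → row u ≢ row v → Apart G u v
  apart-col {u} {v} col≡ row≢ = row≢ ∘ cong row ,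
    λ uv → proj₁ (does⁻ (thinnedEdge? n a (toℕ u) (toℕ v)) uv) col≡

  apart-row : ∀ {u v} → col u ≢ col v → row u ≡ row v → row u < r → Apart G u v
  apart-row {u} {v} col≢ row≡ row<r = col≢ ∘ cong col ,
    λ uv → <⇒≱ row<r (proj₂ (does⁻ (thinnedEdge? n a (toℕ u) (toℕ v)) uv) row≡)

  -- In a second column take `u` in the row of `y` and `v` in the row of `x`. Then x, u, z, v, y is
  -- an induced path: the pairs x, v and u, y lie in common full rows, and all other pairs that are
  -- not consecutive lie in common columns.
  onPath-column′ : ∀ {x y z} → col x ≡ col y → col x ≡ col z →
    row x ≢ row y → row y ≢ row z → row x ≢ row z → row x < r → row y < r → OnPath G x y z
  onPath-column′ {x} {y} {z} x≡y x≡z x≢y y≢z x≢z x<r y<r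
    with q , q<a , q≢ ← ≢-other 2≤a (col x)
    with u , u-row , refl ← fullRowVertex y<r q<a
    with v , v-row , v-col ← fullRowVertex x<r q<a
    = _ , consPath G x (consPath G u (consPath G z (consPath G v (singletonPath G y)
        (edge-row≢ v≢y (λ eq → x≢y (trans (sym v-row) eq)))
        (λ ()))
        (edge-row≢ (λ eq → v≢y (trans (sym eq) (trans (sym x≡z) x≡y))) (λ eq → x≢z (sym (trans eq v-row))))
        (λ { 0F → apart-col (trans (sym x≡z) x≡y) (y≢z ∘ sym) }))
        (edge-row≢ (λ eq → q≢ (trans eq (sym x≡z))) (λ eq → y≢z (trans (sym u-row) eq)))
        (λ { 0F → apart-col (sym v-col) (λ eq → x≢y (trans (sym v-row) (trans (sym eq) u-row)))
           ; 1F → apart-row (λ eq → q≢ (trans eq (sym x≡y))) u-row (subst (_< r) (sym u-row) y<r) }))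
        (edge-row≢ (q≢ ∘ sym) (λ eq → x≢y (trans eq u-row)))
        (λ { 0F → apart-col x≡z x≢z
           ; 1F → apart-row (λ eq → q≢ (trans (sym v-col) (sym eq))) (sym v-row) x<r
           ; 2F → apart-col x≡y x≢y })
      , 0F , 4F , 2F , refl , refl , refl
    where
    v≢y : col v ≢ col y
    v≢y = λ eq → q≢ (trans (sym v-col) (trans eq (sym x≡y)))

  -- At most one of three distinct rows is the incomplete row `r`. The vertex in that row is put in
  -- the middle of the path.
  onPath-column : ∀ {x y z} → col x ≡ col y → col x ≡ col z →
    row x ≢ row y → row y ≢ row z → row x ≢ row z → OnPath G x y z
  onPath-column {x} {y} {z} x≡y x≡z x≢y y≢z x≢z
    with m≤n⇒m<n∨m≡n (row≤ x) | m≤n⇒m<n∨m≡n (row≤ y)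
  ... | inj₁ x<r | inj₁ y<r = onPath-column′ x≡y x≡z x≢y y≢z x≢z x<r y<r
  ... | inj₁ x<r | inj₂ y≡r = OnPath-swap G (OnPath-rotate G (OnPath-rotate G
    (onPath-column′ x≡z x≡y x≢z (y≢z ∘ sym) x≢y x<r
      (≤∧≢⇒< (row≤ z) (λ z≡r → y≢z (trans y≡r (sym z≡r)))))))
  ... | inj₂ x≡r | _ = OnPath-rotate G (OnPath-rotate G
    (onPath-column′ (trans (sym x≡y) x≡z) (sym x≡y) y≢z (x≢z ∘ sym) (x≢y ∘ sym)
      (≤∧≢⇒< (row≤ y) (λ y≡r → x≢y (trans x≡r (sym y≡r))))
      (≤∧≢⇒< (row≤ z) (λ z≡r → x≢z (trans x≡r (sym z≡r))))))

  -- The path is x, z, y: the two conditions on the rows make `z` adjacent to both ends.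
  onPath-wedge : ∀ {x y z} → col x ≡ col y → col x ≢ col z → row x ≢ row y →
    (row x ≡ row z → r ≤ row x) → (row z ≡ row y → r ≤ row z) → OnPath G x y z
  onPath-wedge {x} {y} {z} x≡y x≢z x≢y xz zy = _ ,
    consPath G x (consPath G z (singletonPath G y)
      (edge (λ eq → x≢z (trans x≡y (sym eq))) zy) (λ ()))
      (edge x≢z xz) (λ { 0F → apart-col x≡y x≢y }) ,
    0F , 2F , 1F , refl , refl , refl

  -- The path is z, y, w, x. Here z and x share a full row, while z, w and y, x share columns.
  onPath-w-column-z : ∀ {x y z w} → col x ≡ col y → col x ≢ col z → row x ≢ row y →
    row z ≡ row x → row z < r → col w ≡ col z → row w ≢ row x → row w ≢ row y → OnPath G x y z
  onPath-w-column-z {x} {y} {z} {w} x≡y x≢z x≢y z≡x z<r w≡z w≢x w≢y = _ ,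
    consPath G z (consPath G y (consPath G w (singletonPath G x)
      (edge-row≢ (λ eq → x≢z (trans (sym eq) w≡z)) w≢x) (λ ()))
      (edge-row≢ (λ eq → x≢z (trans x≡y (trans eq w≡z))) (w≢y ∘ sym))
      (λ { 0F → apart-col (sym x≡y) (x≢y ∘ sym) }))
      (edge-row≢ (λ eq → x≢z (trans x≡y (sym eq))) (λ eq → x≢y (trans (sym z≡x) eq)))
      (λ { 0F → apart-col (sym w≡z) (λ eq → w≢x (trans (sym eq) z≡x))
         ; 1F → apart-row (x≢z ∘ sym) z≡x z<r }) ,
    3F , 1F , 0F , refl , refl , refl

  -- With `u` in the row of `y` and the column of `z`, the path is x, u, w, z, y. Here x, z and u, y
  -- share full rows, u and z share a column, and x, w, y share another one.
  onPath-w-column-x : ∀ {x y z w} → col x ≡ col y → col x ≢ col z → row x ≢ row y →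
    row z ≡ row x → row z < r → row y < r →
    col w ≡ col x → row w ≢ row x → row w ≢ row y → OnPath G x y z
  onPath-w-column-x {x} {y} {z} {w} x≡y x≢z x≢y z≡x z<r y<r w≡x w≢x w≢y
    with u , u-row , u-col ← fullRowVertex y<r (col< z)
    = _ , consPath G x (consPath G u (consPath G w (consPath G z (singletonPath G y)
        (edge-row≢ (λ eq → x≢z (trans x≡y (sym eq))) (λ eq → x≢y (trans (sym z≡x) eq)))
        (λ ()))
        (edge-row≢ (λ eq → x≢z (trans (sym w≡x) eq)) (λ eq → w≢x (trans eq z≡x)))
        (λ { 0F → apart-col (trans w≡x x≡y) w≢y }))
        (edge-row≢ (λ eq → x≢u (trans (sym w≡x) (sym eq))) (λ eq → w≢y (trans (sym eq) u-row)))
        (λ { 0F → apart-col u-col (λ eq → x≢y (trans (sym z≡x) (trans (sym eq) u-row)))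
           ; 1F → apart-row (λ eq → x≢u (trans x≡y (sym eq))) u-row (subst (_< r) (sym u-row) y<r) }))
        (edge-row≢ x≢u (λ eq → x≢y (trans eq u-row)))
        (λ { 0F → apart-col (sym w≡x) (w≢x ∘ sym)
           ; 1F → apart-row x≢z (sym z≡x) (subst (_< r) z≡x z<r)
           ; 2F → apart-col x≡y x≢y })
      , 0F , 4F , 3F , refl , refl , refl
    where
    x≢u : col x ≢ col u
    x≢u eq = x≢z (trans eq u-col)

  binary : ∀ {p q} → p < 2 → q < 2 → p ≢ q → p ≡ 0 ⊎ q ≡ 0
  binary {zero}              _                _                _   = inj₁ refl
  binary {suc _} {zero}      _                _                _   = inj₂ refl
  binary {1}     {1}         _                _                1≢1 = contradiction refl 1≢1
  binary {1}     {suc (suc _)} _ (s≤s (s≤s ())) _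
  binary {suc (suc _)} {suc _} (s≤s (s≤s ())) _ _

  -- As `x` and `z` are not adjacent, the path makes a detour through a vertex `w` of a third row. A
  -- full row provides `w` in the column of `z` if there are at least three full rows or if `y` lies
  -- outside them. Otherwise `w` is taken from the incomplete row; with only two columns, it lies in
  -- that of `x` or in that of `z`.
  onPath-sameRow : ∀ {x y z} → col x ≡ col y → col x ≢ col z → row x ≢ row y →
    row z ≡ row x → row z < r → OnPath G x y z
  onPath-sameRow {x} {y} {z} x≡y x≢z x≢y z≡x z<r with 3 ≤? r | row y <? r
  ... | yes 3≤r | _
    with l , l<r , l≢x , l≢y ← ≢-third 3≤r (row x) (row y)
    with w , refl , w-col ← fullRowVertex l<r (col< z)
    = onPath-w-column-z x≡y x≢z x≢y z≡x z<r w-col l≢x l≢y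
  ... | no _ | no y≮r
    with l , l<r , l≢x ← ≢-other (≤-trans 2≤a a≤r) (row x)
    with w , refl , w-col ← fullRowVertex l<r (col< z)
    = onPath-w-column-z x≡y x≢z x≢y z≡x z<r w-col l≢x (λ eq → y≮r (subst (_< r) eq l<r))
  -- Here a = r = 2, and the vertex 4 is the only one that is not in a full row.
  ... | no r≤2 | yes y<r
    with w , w-row , w-col ← vertexAt r 0 (<-≤-trans (s≤s z≤n) 2≤a)
           (≤-<-trans (*-monoˡ-≤ a (≤-trans (≤-pred (≰⇒> r≤2)) 2≤a)) a*a<n)
    with binary (col<2 x) (col<2 z) x≢z
    where
    col<2 : ∀ v → col v < 2
    col<2 v = <-≤-trans (col< v) (≤-trans a≤r (≤-pred (≰⇒> r≤2)))
  ... | inj₁ x≡0 = onPath-w-column-x x≡y x≢z x≢y z≡x z<r y<r (trans w-col (sym x≡0))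
    (λ eq → <⇒≢ (subst (_< r) z≡x z<r) (trans (sym eq) w-row))
    (λ eq → <⇒≢ y<r (trans (sym eq) w-row))
  ... | inj₂ z≡0 = onPath-w-column-z x≡y x≢z x≢y z≡x z<r (trans w-col (sym z≡0))
    (λ eq → <⇒≢ (subst (_< r) z≡x z<r) (trans (sym eq) w-row))
    (λ eq → <⇒≢ y<r (trans (sym eq) w-row))

  -- If `z` lies in another column, it is adjacent to both `x` and `y` unless it shares a full row
  -- with one of them.
  onPath : ∀ {x y z} → x ≢ y → y ≢ z → x ≢ z → col x ≡ col y → OnPath G x y z
  onPath {x} {y} {z} x≢y y≢z x≢z x≡y
    with rx≢ry ← (λ (row≡ : row x ≡ row y) → x≢y (row-col-injective row≡ x≡y))
    with col x ≟ col z
  ... | yes x≡z = onPath-column x≡y x≡z rx≢ry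
    (λ row≡ → y≢z (row-col-injective row≡ (trans (sym x≡y) x≡z)))
    (λ row≡ → x≢z (row-col-injective row≡ x≡z))
  ... | no col≢ with row z <? r | row z ≟ row x | row z ≟ row y
  ... | no z≮r  | _ | _ = onPath-wedge x≡y col≢ rx≢ry (λ eq → subst (r ≤_) (sym eq) (≮⇒≥ z≮r)) (λ _ → ≮⇒≥ z≮r)
  ... | yes z<r | yes z≡x | _       = onPath-sameRow x≡y col≢ rx≢ry z≡x z<r
  ... | yes z<r | no  z≢x | yes z≡y = OnPath-swap G
    (onPath-sameRow (sym x≡y) (λ eq → col≢ (trans x≡y eq)) (rx≢ry ∘ sym) z≡y z<r)
  ... | yes z<r | no  z≢x | no  z≢y = onPath-wedge x≡y col≢ rx≢ry
    (λ eq → contradiction (sym eq) z≢x) (λ eq → contradiction eq z≢y)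

  monophonicPosition⇒≤ : ∀ S → InMonophonicPosition G S → ∣ S ∣ ≤ a
  monophonicPosition⇒≤ S mono = ≮⇒≥ λ a<∣S∣ →
    let i , j , i<j , part≡     = pigeonhole a<∣S∣ (turánPart n a ∘ element S)
        -- Since `a` is at least 2, `S` has at least three elements, so there is one besides the two
        -- in a common column.
        k , k< , k≢i , k≢j      = ≢-third (≤-trans (s≤s 2≤a) a<∣S∣) (toℕ i) (toℕ j)
        l                       = fromℕ< k<
        l≡                      = toℕ-fromℕ< k<
        distinct : ∀ {i j} → toℕ i ≢ toℕ j → element S i ≢ element S j
        distinct i≢j eq         = i≢j (cong toℕ (element-injective S eq))
        x≢y = distinct {i} {j} (<⇒≢ i<j)
        y≢z = distinct {j} {l} (λ eq → k≢j (trans (sym l≡) (sym eq)))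
        x≢z = distinct {i} {l} (λ eq → k≢i (trans (sym l≡) (sym eq)))
    in  onPath⇒¬monophonicPosition G x≢y y≢z x≢z
          (element-∈ S i) (element-∈ S j) (element-∈ S l)
          (onPath x≢y y≢z x≢z
            (trans (sym (toℕ-mod a _)) (trans (cong toℕ part≡) (toℕ-mod a _))))
          mono

  diagonal : (i : Fin a) → ∃[ v ] row v ≡ toℕ i × col v ≡ toℕ i
  diagonal i = fullRowVertex (<-≤-trans (toℕ<n i) a≤r) (toℕ<n i)

  diagonal-clique : IsClique G (proj₁ ∘ diagonal)
  diagonal-clique i j i≢j = edge-row≢
    (λ eq → i≢j (toℕ-injective (trans (sym (colᵈ i)) (trans eq (colᵈ j)))))
    (λ eq → i≢j (toℕ-injective (trans (sym (rowᵈ i)) (trans eq (rowᵈ j)))))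
    where
    rowᵈ : ∀ i → row (proj₁ (diagonal i)) ≡ toℕ i
    rowᵈ i = proj₁ (proj₂ (diagonal i))
    colᵈ : ∀ i → col (proj₁ (diagonal i)) ≡ toℕ i
    colᵈ i = proj₂ (proj₂ (diagonal i))

  mpNumber : IsMpNumber (thinnedTurán n a) a
  mpNumber =
    (D , mono , ≤-antisym (monophonicPosition⇒≤ D mono) (clique⇒≤∣image∣ G diagonal-clique)) ,
    λ { _ (S , monoS , refl) → monophonicPosition⇒≤ S monoS }
    where
    D : Subset n
    D = image (proj₁ ∘ diagonal)
    mono : InMonophonicPosition G D
    mono = clique-monophonicPosition G diagonal-clique

-- Decidability and existence of mex

-- Searches the codes in `Fin (n ^ k)`. Decoding recovers a function only up to pointwise equality,
-- which `P` therefore has to respect.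
anyFunction? : ∀ {k n} {P : (Fin k → Fin n) → Set} → (∀ {f g} → f ≗ g → P f → P g) →
  (∀ f → Dec (P f)) → Dec (∃[ f ] P f)
anyFunction? resp P? = map′
  (λ (i , Pi) → finToFun i , Pi)
  (λ (f , Pf) → funToFin f , resp (sym ∘ finToFun-funToFin f) Pf)
  (any? (λ i → P? (finToFun i)))

infix 4 _≈_

_≈_ : ∀ {n} → Graph n → Graph n → Set
G ≈ H = ∀ u v → Graph.adj G u v ≡ Graph.adj H u v

-- Searches the adjacency matrices, coded as subsets of `n * n` positions. Decoding symmetrises the
-- matrix and clears its diagonal, so every subset yields a graph and every graph arises up to `≈`.
anyGraph? : ∀ {n} {P : Graph n → Set} → (∀ {G H} → G ≈ H → P G → P H) →
  (∀ G → Dec (P G)) → Dec (∃[ G ] P G)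
anyGraph? {n} resp P? = map′
  (λ (S , PS) → decode S , PS)
  (λ (G , PG) → encode G , resp (decode-encode G) PG)
  (anySubset? (λ S → P? (decode S)))
  where
  -- The complete graph, each vertex being its own part; it is the mask that clears the diagonal.
  K : Graph n
  K = completeMultipartite id

  decode : Subset (n * n) → Graph n
  decode S = record
    { adj        = λ u v → Graph.adj K u v ∧ (bit u v ∨ bit v u)
    ; adj-sym    = λ u v → cong₂ _∧_ (Graph.adj-sym K u v) (∨-comm (bit u v) (bit v u))
    ; adj-irrefl = λ v → cong (_∧ (bit v v ∨ bit v v)) (Graph.adj-irrefl K v)
    }
    where
    bit : Fin n → Fin n → Bool
    bit u v = Vec.lookup S (combine u v)

  encode : Graph n → Subset (n * n)
  encode G = Vec.tabulate λ i → let u , v = remQuot n i in Graph.adj G u v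

  decode-encode : ∀ G → G ≈ decode (encode G)
  decode-encode G u v = sym (trans
    (cong₂ (λ b c → Graph.adj K u v ∧ (b ∨ c)) (bit≡ u v) (trans (bit≡ v u) (Graph.adj-sym G v u)))
    (trans (cong (Graph.adj K u v ∧_) (∨-idem _)) loopless))
    where
    bit≡ : ∀ u v → Vec.lookup (encode G) (combine u v) ≡ Graph.adj G u v
    bit≡ u v = trans (lookup∘tabulate _ (combine u v))
      (cong (λ (x , y) → Graph.adj G x y) (remQuot-combine u v))
    loopless : Graph.adj K u v ∧ Graph.adj G u v ≡ Graph.adj G u v
    loopless with u Fin.≟ v
    ... | yes refl = sym (Graph.adj-irrefl G u)
    ... | no  _    = refl

size-resp-≈ : ∀ {n} {G H : Graph n} → G ≈ H → size G ≡ size H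
size-resp-≈ {n} {G} {H} G≈H = trans (size-∑ G) (trans
  (sum-cong-≗ {n = n} (λ u → sum-cong-≗ {n = n} (λ v →
    cong (λ b → ⟦ does (u Fin.<? v) ∧ b ⟧) (G≈H u v))))
  (sym (size-∑ H)))

monophonicPosition-resp-≈ : ∀ {n} {G H : Graph n} → G ≈ H →
  ∀ S → InMonophonicPosition G S → InMonophonicPosition H S
monophonicPosition-resp-≈ G≈H S mono P = mono record
  { vertex    = vertex P
  ; distinct  = distinct P
  ; path      = λ i j eq → subst T (sym (G≈H _ _)) (path P i j eq)
  ; chordless = λ i j lt → chordless P i j lt ∘ subst T (G≈H _ _)
  }
  where open MonophonicPath

mpNumber-resp-≈ : ∀ {n a} {G H : Graph n} → G ≈ H → IsMpNumber G a → IsMpNumber H a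
mpNumber-resp-≈ {G = G} {H} G≈H ((S , mono , ∣S∣≡a) , maximal) =
  (S , monophonicPosition-resp-≈ {G = G} {H} G≈H S mono , ∣S∣≡a) ,
  λ k (S , mono , ∣S∣≡k) →
    maximal k (S , monophonicPosition-resp-≈ {G = H} {G} (λ u v → sym (G≈H u v)) S mono , ∣S∣≡k)

module _ {n} (G : Graph n) where
  open MonophonicPath

  private
    -- The fields of `MonophonicPath` are restated for a bare function, so that a violating path can
    -- be searched for among all functions.
    BadPath : Subset n → (k : ℕ) → (Fin k → Fin n) → Set
    BadPath S k f =
      ((∀ i j → f i ≡ f j → i ≡ j)
        × (∀ i j → toℕ j ≡ suc (toℕ i) → Adj G (f i) (f j))
        × (∀ i j → suc (toℕ i) < toℕ j → ¬ Adj G (f i) (f j)))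
      × 2 < ∣ S ∩ image f ∣

    badPath? : ∀ S k f → Dec (BadPath S k f)
    badPath? S k f =
      (all? (λ i → all? λ j → (f i Fin.≟ f j) →-dec (i Fin.≟ j))
        ×-dec all? (λ i → all? λ j → (toℕ j ≟ suc (toℕ i)) →-dec T? _)
        ×-dec all? (λ i → all? λ j → (suc (toℕ i) <? toℕ j) →-dec ¬? (T? _)))
      ×-dec (2 <? ∣ S ∩ image f ∣)

    badPath-resp-≗ : ∀ {S k f g} → f ≗ g → BadPath S k f → BadPath S k g
    badPath-resp-≗ {S} f≗g ((inj , adj , ¬adj) , 2<) =
      ( (λ i j eq → inj i j (trans (f≗g i) (trans eq (sym (f≗g j)))))
      , (λ i j eq → subst₂ (Adj G) (f≗g i) (f≗g j) (adj i j eq))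
      , (λ i j lt → ¬adj i j lt ∘ subst₂ (Adj G) (sym (f≗g i)) (sym (f≗g j))) ) ,
      subst (λ V → 2 < ∣ S ∩ ⋃ V ∣) (tabulate-cong (cong ⁅_⁆ ∘ f≗g)) 2<

    hasBadPath? : ∀ S k → Dec (∃[ f ] BadPath S k f)
    hasBadPath? S k = anyFunction? (badPath-resp-≗ {S} {k}) (badPath? S k)

  -- The vertices of a path are distinct, so searching the paths with at most `n` vertices is
  -- exhaustive.
  monophonicPosition? : ∀ S → Dec (InMonophonicPosition G S)
  monophonicPosition? S = map′ sound complete (¬? (anyUpTo? (hasBadPath? S) (suc n)))
    where
    sound : ¬ (∃[ k ] k < suc n × ∃[ f ] BadPath S k f) → InMonophonicPosition G S
    sound ∄bad P = ≮⇒≥ λ 2< → ∄bad (_ , s≤s (injective⇒≤ {f = vertex P} (distinct P)) ,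
      vertex P , ((λ i j → distinct P) , path P , chordless P) , 2<)

    complete : InMonophonicPosition G S → ¬ (∃[ k ] k < suc n × ∃[ f ] BadPath S k f)
    complete mono (k , _ , f , (inj , adj , ¬adj) , 2<) = <⇒≱ 2< (mono record
      { vertex = f ; distinct = λ {i} {j} → inj i j ; path = adj ; chordless = ¬adj })

  mpNumber? : ∀ a → Dec (IsMpNumber G a)
  mpNumber? a =
    anySubset? (λ S → monophonicPosition? S ×-dec (∣ S ∣ ≟ a))
    ×-dec map′ sound complete (¬? (anySubset? (λ S → monophonicPosition? S ×-dec (a <? ∣ S ∣))))
    where
    sound : ¬ (∃[ S ] InMonophonicPosition G S × a < ∣ S ∣) →
      ∀ k → ∃[ S ] InMonophonicPosition G S × ∣ S ∣ ≡ k → k ≤ a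
    sound ∄S _ (S , mono , refl) = ≮⇒≥ λ a< → ∄S (S , mono , a<)

    complete : (∀ k → ∃[ S ] InMonophonicPosition G S × ∣ S ∣ ≡ k → k ≤ a) →
      ¬ (∃[ S ] InMonophonicPosition G S × a < ∣ S ∣)
    complete maximal (S , mono , a<) = <⇒≱ a< (maximal _ (S , mono , refl))

-- Searches downwards from `b`; the given witness settles the case in which the search arrives at 0.
greatest : ∀ {P : ℕ → Set} → (∀ m → Dec (P m)) → ∀ b → (∀ k → P k → k ≤ b) →
  ∀ {m} → P m → ∃[ k ] IsGreatest P k
greatest P? zero bound Pm with z≤n ← bound _ Pm = 0 , Pm , bound
greatest P? (suc b) bound Pm with P? (suc b)
... | yes Pb = suc b , Pb , bound
... | no ¬Pb = greatest P? b
  (λ k Pk → ≤-pred (≤∧≢⇒< (bound k Pk) λ { refl → ¬Pb Pk })) Pm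

-- The bounds on mex and its existence

module _ {n a : ℕ} .{{_ : NonZero a}} (a≥2 : a ≥ 2) (n≥ : n ≥ a ^ 2 + 1) where

  mex-bounds : ∀ {m} → IsMex n a m → t n a ∸ (n / a) * (a C 2) ≤ m × m ≤ t n a ∸ 1
  mex-bounds ((G , mp , refl) , maximal) =
    ≤-trans (m≤n+o⇒m∸n≤o _ (n / a * (a C 2))
      (≤-trans (t≤size-thinnedTurán a n) (≤-reflexive (+-comm _ (n / a * (a C 2))))))
      (maximal _ (thinnedTurán n a , ThinnedTurán.mpNumber n a a≥2 n≥ , refl)) ,
    ≤-pred (≤-trans (mpNumber⇒size<t G n≥ mp) (m≤n+m∸n (t n a) 1))

  mex-exists : ∃[ m ] IsMex n a m
  mex-exists = greatest
    (λ m → anyGraph?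
      (λ {G} {H} G≈H (mp , size≡m) →
        mpNumber-resp-≈ {G = G} {H} G≈H mp ,
        trans (sym (size-resp-≈ {G = G} {H} G≈H)) size≡m)
      (λ G → mpNumber? G a ×-dec (size G ≟ m)))
    (t n a)
    (λ { _ (G , mp , refl) → <⇒≤ (mpNumber⇒size<t G n≥ mp) })
    (thinnedTurán n a , ThinnedTurán.mpNumber n a a≥2 n≥ , refl)

-- Rational estimates

private
  ι : ℕ → ℚ
  ι k = + k ℚ./ 1

toℚᵘ-ι : ∀ k → toℚᵘ (ι k) ≃ mkℚᵘ (+ k) 0
toℚᵘ-ι k = toℚᵘ-fromℚᵘ (mkℚᵘ (+ k) 0)

ι-* : ∀ m n → ι m ℚ.* ι n ≡ ι (m * n)
ι-* m n = toℚᵘ-injective (≃-trans (toℚᵘ-homo-* (ι m) (ι n))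
  (≃-trans (ℚᵘ.*-cong (toℚᵘ-ι m) (toℚᵘ-ι n))
  (≃-trans (*≡* (cong (ℤ._* + 1) (sym (pos-* m n)))) (≃-sym (toℚᵘ-ι (m * n))))))

ι-≤-+ : ∀ {m n k} → m ≤ n + k → ι m ℚ.≤ ι n ℚ.+ ι k
ι-≤-+ {m} {n} {k} m≤n+k = toℚᵘ-cancel-≤ (begin
  toℚᵘ (ι m)                    ≃⟨ toℚᵘ-ι m ⟩
  mkℚᵘ (+ m) 0                  ≤⟨ *≤* (subst₂ ℤ._≤_ (sym (ℤ.*-identityʳ (+ m))) (sym rhs) (+≤+ m≤n+k)) ⟩
  mkℚᵘ (+ n) 0 ℚᵘ.+ mkℚᵘ (+ k) 0 ≃⟨ ℚᵘ.+-cong (≃-sym (toℚᵘ-ι n)) (≃-sym (toℚᵘ-ι k)) ⟩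
  toℚᵘ (ι n) ℚᵘ.+ toℚᵘ (ι k)    ≃⟨ ≃-sym (toℚᵘ-homo-+ (ι n) (ι k)) ⟩
  toℚᵘ (ι n ℚ.+ ι k)            ∎)
  where
  open ℚᵘ.≤-Reasoning
  rhs : (+ n ℤ.* + 1 ℤ.+ + k ℤ.* + 1) ℤ.* + 1 ≡ + (n + k)
  rhs = trans (ℤ.*-identityʳ _) (cong₂ ℤ._+_ (ℤ.*-identityʳ (+ n)) (ℤ.*-identityʳ (+ k)))

-- A positive `ε` has numerator at least 1, so after clearing its denominator `y` alone already
-- exceeds the left side.
ι-<-* : ∀ {e y} ε → 0ℚ ℚ.< ε → e * ℚ.↧ₙ ε < y → ι e ℚ.< ε ℚ.* ι y
ι-<-* {e} {y} (mkℚ (+ 0)      d c) (*<* (+<+ ())) lt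
ι-<-* {e} {y} ε@(mkℚ (+[1+ p ]) d c) 0<ε lt = toℚᵘ-cancel-< (begin-strict
  toℚᵘ (ι e)                         ≃⟨ toℚᵘ-ι e ⟩
  mkℚᵘ (+ e) 0                       <⟨ *<* numerators ⟩
  mkℚᵘ +[1+ p ] d ℚᵘ.* mkℚᵘ (+ y) 0  ≃⟨ ℚᵘ.*-cong (≃-refl {mkℚᵘ +[1+ p ] d}) (≃-sym (toℚᵘ-ι y)) ⟩
  toℚᵘ ε ℚᵘ.* toℚᵘ (ι y)             ≃⟨ ≃-sym (toℚᵘ-homo-* ε (ι y)) ⟩
  toℚᵘ (ε ℚ.* ι y)                   ∎)
  where
  open ℚᵘ.≤-Reasoning
  numerators : + e ℤ.* + (suc d * 1) ℤ.< (+[1+ p ] ℤ.* + y) ℤ.* + 1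
  numerators = subst₂ ℤ._<_ (trans (cong (λ x → + (e * x)) (sym (*-identityʳ (suc d)))) (pos-* e (suc d * 1)))
    (sym (trans (ℤ.*-identityʳ _) (sym (pos-* (suc p) y))))
    (+<+ (<-≤-trans lt (m≤m+n y (p * y))))
ι-<-* {e} {y} (mkℚ (ℤ.-[1+ _ ]) d c) (*<* ()) lt

p≤q+e⇒p-q≤e : ∀ p q {e} → p ℚ.≤ q ℚ.+ e → p ℚ.- q ℚ.≤ e
p≤q+e⇒p-q≤e p q {e} p≤ = subst (p ℚ.- q ℚ.≤_) (xyx⁻¹≈y q e) (ℚ.+-monoˡ-≤ (ℚ.- q) p≤)

∣p-q∣≤e : ∀ {p q e} → p ℚ.≤ q ℚ.+ e → q ℚ.≤ p ℚ.+ e → ℚ.∣ p ℚ.- q ∣ ℚ.≤ e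
∣p-q∣≤e {p} {q} {e} p≤ q≤ with ℚ.∣p∣≡p∨∣p∣≡-p (p ℚ.- q)
... | inj₁ eq = subst (ℚ._≤ e) (sym eq) (p≤q+e⇒p-q≤e p q p≤)
... | inj₂ eq = subst (ℚ._≤ e) (sym (trans eq (⁻¹-anti-homo-// p q))) (p≤q+e⇒p-q≤e q p q≤)

-- Scaling by `D` turns f / g - 1 into (X - Y) / Y, whose absolute value is at most E / Y < ε. If
-- `g` were 0, then `Y` would be 0 and `E` negative.
÷-near-1 : ∀ {f g D : ℚ} {X Y E} ε → D ℚ.* f ≡ ι X → D ℚ.* g ≡ ι Y →
  X ≤ Y + E → Y ≤ X + E → 0ℚ ℚ.< ε → E * ℚ.↧ₙ ε < Y →
  Σ[ g≢0 ∈ ℚ.NonZero g ] ℚ.∣ (ℚ._÷_ f g {{g≢0}}) ℚ.- 1ℚ ∣ ℚ.< ε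
÷-near-1 {f} {g} {D} {X} {Y} {E} ε Df≡ Dg≡ X≤ Y≤ 0<ε E<Y = g≢0 , close
  where
  instance
    Y-nonNeg : ℚ.NonNegative (ι Y)
    Y-nonNeg = ℚ.normalize-nonNeg Y 1
    E-nonNeg : ℚ.NonNegative (ι E)
    E-nonNeg = ℚ.normalize-nonNeg E 1
  ιE<ε*ιY : ι E ℚ.< ε ℚ.* ι Y
  ιE<ε*ιY = ι-<-* {E} {Y} ε 0<ε E<Y
  g≢0 : ℚ.NonZero g
  g≢0 = ℚ.≢-nonZero λ g≡0 → ℚ.<-irrefl refl (ℚ.≤-<-trans (ℚ.nonNegative⁻¹ (ι E)) (subst (ι E ℚ.<_)
    (trans (cong (ε ℚ.*_) (trans (sym Dg≡) (trans (cong (D ℚ.*_) g≡0) (ℚ.*-zeroʳ D)))) (ℚ.*-zeroʳ ε))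
    ιE<ε*ιY))
  instance
    _ : ℚ.NonZero g
    _ = g≢0
  f÷g*ιY : (f ℚ.÷ g) ℚ.* ι Y ≡ ι X
  f÷g*ιY = begin
    (f ℚ.* ℚ.1/ g) ℚ.* ι Y        ≡⟨ cong ((f ℚ.* ℚ.1/ g) ℚ.*_) (trans (sym Dg≡) (ℚ.*-comm D g)) ⟩
    (f ℚ.* ℚ.1/ g) ℚ.* (g ℚ.* D)  ≡⟨ ℚ.*-assoc f (ℚ.1/ g) (g ℚ.* D) ⟩
    f ℚ.* (ℚ.1/ g ℚ.* (g ℚ.* D))  ≡⟨ cong (f ℚ.*_) (sym (ℚ.*-assoc (ℚ.1/ g) g D)) ⟩
    f ℚ.* (ℚ.1/ g ℚ.* g ℚ.* D)    ≡⟨ cong (λ x → f ℚ.* (x ℚ.* D)) (ℚ.*-inverseˡ g) ⟩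
    f ℚ.* (1ℚ ℚ.* D)              ≡⟨ cong (f ℚ.*_) (ℚ.*-identityˡ D) ⟩
    f ℚ.* D                       ≡⟨ ℚ.*-comm f D ⟩
    D ℚ.* f                       ≡⟨ Df≡ ⟩
    ι X                           ∎
    where open ≡-Reasoning
  cleared : (f ℚ.÷ g ℚ.- 1ℚ) ℚ.* ι Y ≡ ι X ℚ.- ι Y
  cleared = trans (ℚ.*-distribʳ-+ (ι Y) (f ℚ.÷ g) (ℚ.- 1ℚ))
    (cong₂ ℚ._+_ f÷g*ιY (trans (sym (ℚ.neg-distribˡ-* 1ℚ (ι Y))) (cong (λ x → ℚ.- x) (ℚ.*-identityˡ (ι Y)))))
  close : ℚ.∣ f ℚ.÷ g ℚ.- 1ℚ ∣ ℚ.< ε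
  close = ℚ.*-cancelʳ-<-nonNeg (ι Y) (begin-strict
    ℚ.∣ f ℚ.÷ g ℚ.- 1ℚ ∣ ℚ.* ι Y           ≡⟨ cong (ℚ.∣ f ℚ.÷ g ℚ.- 1ℚ ∣ ℚ.*_)
                                                (sym (ℚ.0≤p⇒∣p∣≡p (ℚ.nonNegative⁻¹ (ι Y)))) ⟩
    ℚ.∣ f ℚ.÷ g ℚ.- 1ℚ ∣ ℚ.* ℚ.∣ ι Y ∣     ≡⟨ sym (ℚ.∣p*q∣≡∣p∣*∣q∣ (f ℚ.÷ g ℚ.- 1ℚ) (ι Y)) ⟩
    ℚ.∣ (f ℚ.÷ g ℚ.- 1ℚ) ℚ.* ι Y ∣         ≡⟨ cong ℚ.∣_∣ cleared ⟩
    ℚ.∣ ι X ℚ.- ι Y ∣                      ≤⟨ ∣p-q∣≤e (ι-≤-+ {X} {Y} {E} X≤) (ι-≤-+ {Y} {X} {E} Y≤) ⟩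
    ι E                                    <⟨ ιE<ε*ιY ⟩
    ε ℚ.* ι Y                              ∎)
    where open ℚ.≤-Reasoning

-- With `a = suc b`, the factor 2a clears both denominators of (1 - 1/a) n²/2.
density-* : ∀ b n → ι (2 * suc b) ℚ.* ((1ℚ ℚ.- + 1 ℚ./ suc b) ℚ.* (+ (n ^ 2) ℚ./ 2)) ≡ ι (b * n ^ 2)
density-* b n = toℚᵘ-injective (begin-equality
  toℚᵘ (ι (2 * suc b) ℚ.* ((1ℚ ℚ.- + 1 ℚ./ suc b) ℚ.* (+ (n ^ 2) ℚ./ 2)))
    ≃⟨ toℚᵘ-homo-* (ι (2 * suc b)) _ ⟩
  toℚᵘ (ι (2 * suc b)) ℚᵘ.* toℚᵘ ((1ℚ ℚ.- + 1 ℚ./ suc b) ℚ.* (+ (n ^ 2) ℚ./ 2))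
    ≃⟨ ℚᵘ.*-cong (toℚᵘ-ι (2 * suc b)) (≃-trans (toℚᵘ-homo-* (1ℚ ℚ.- + 1 ℚ./ suc b) (+ (n ^ 2) ℚ./ 2))
         (ℚᵘ.*-cong complement (toℚᵘ-fromℚᵘ (mkℚᵘ (+ (n ^ 2)) 1)))) ⟩
  mkℚᵘ (+ (2 * suc b)) 0 ℚᵘ.* (mkℚᵘ (+ b) b ℚᵘ.* mkℚᵘ (+ (n ^ 2)) 1)
    ≃⟨ *≡* numerators ⟩
  mkℚᵘ (+ (b * n ^ 2)) 0
    ≃⟨ ≃-sym (toℚᵘ-ι (b * n ^ 2)) ⟩
  toℚᵘ (ι (b * n ^ 2)) ∎)
  where
  open ℚᵘ.≤-Reasoning
  complement : toℚᵘ (1ℚ ℚ.- + 1 ℚ./ suc b) ≃ mkℚᵘ (+ b) b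
  complement = ≃-trans (toℚᵘ-homo-+ 1ℚ (ℚ.- (+ 1 ℚ./ suc b)))
    (≃-trans (ℚᵘ.+-cong (≃-refl {toℚᵘ 1ℚ}) (≃-trans
      (toℚᵘ-homo‿- (+ 1 ℚ./ suc b))
      (ℚᵘ.-‿cong (toℚᵘ-fromℚᵘ (mkℚᵘ (+ 1) b)))))
    (*≡* (cong₂ ℤ._*_
      (cong (ℤ._+ ℤ.-[1+ 0 ]) (ℤ.*-identityˡ +[1+ b ]))
      (sym (ℤ.*-identityˡ +[1+ b ])))))
  numerators : (+ (2 * suc b) ℤ.* (+ b ℤ.* + (n ^ 2))) ℤ.* + 1 ≡ + (b * n ^ 2) ℤ.* + (1 * (suc b * 2))
  numerators = trans (ℤ.*-identityʳ _) (trans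
    (trans (cong (+ (2 * suc b) ℤ.*_) (sym (pos-* b (n ^ 2)))) (sym (pos-* (2 * suc b) (b * n ^ 2))))
    (trans (cong +_ (solve 2
        (λ b s → con 2 :* (con 1 :+ b) :* s := s :* (con 1 :* ((con 1 :+ b) :* con 2)))
        refl b (b * n ^ 2)))
      (pos-* (b * n ^ 2) (1 * (suc b * 2)))))
    where open +-*-Solver

-- Integer estimates for the Turán size and mex

2*[1+n]C2 : ∀ n → 2 * (suc n C 2) ≡ suc n * n
2*[1+n]C2 zero    = refl
2*[1+n]C2 (suc n) = begin
  2 * (suc (suc n) C 2)        ≡⟨ cong (2 *_) (sym (nCk+nC[k+1]≡[n+1]C[k+1] (suc n) 1)) ⟩
  2 * (suc n C 1 + suc n C 2)  ≡⟨ cong (λ x → 2 * (x + suc n C 2)) (nC1≡n (suc n)) ⟩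
  2 * (suc n + suc n C 2)      ≡⟨ *-distribˡ-+ 2 (suc n) (suc n C 2) ⟩
  2 * suc n + 2 * (suc n C 2)  ≡⟨ cong (λ x → 2 * suc n + x) (2*[1+n]C2 n) ⟩
  2 * suc n + suc n * n        ≡⟨ solve 1 (λ n → con 2 :* (con 1 :+ n) :+ (con 1 :+ n) :* n
                                      := (con 2 :+ n) :* (con 1 :+ n)) refl n ⟩
  suc (suc n) * suc n          ∎
  where
  open ≡-Reasoning
  open +-*-Solver

module _ (b : ℕ) where

  private
    a : ℕ
    a = suc b

  -- Multiplication by `a` replaces the quotient by the remainder, since a (n/a) = n - n % a.
  a*[n∸n/a] : ∀ n → a * (n ∸ n / a) ≡ b * n + n % a
  a*[n∸n/a] n = +-cancelʳ-≡ (n / a * a) _ _ (begin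
    a * (n ∸ n / a) + n / a * a        ≡⟨ cong (λ x → a * (n ∸ n / a) + x) (*-comm (n / a) a) ⟩
    a * (n ∸ n / a) + a * (n / a)      ≡⟨ sym (*-distribˡ-+ a (n ∸ n / a) (n / a)) ⟩
    a * (n ∸ n / a + n / a)            ≡⟨ cong (a *_) (m∸n+n≡m (m/n≤m n a)) ⟩
    n + b * n                          ≡⟨ +-comm n (b * n) ⟩
    b * n + n                          ≡⟨ cong (λ x → b * n + x) (m≡m%n+[m/n]*n n a) ⟩
    b * n + (n % a + n / a * a)        ≡⟨ sym (+-assoc (b * n) (n % a) (n / a * a)) ⟩
    b * n + n % a + n / a * a          ∎)
    where open ≡-Reasoning

  2a*t-suc : ∀ n → 2 * a * t (suc n) a ≡ 2 * a * t n a + 2 * (b * n + n % a)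
  2a*t-suc n = begin
    2 * a * t (suc n) a                      ≡⟨ cong (2 * a *_) (t-suc a n) ⟩
    2 * a * (t n a + (n ∸ n / a))            ≡⟨ *-distribˡ-+ (2 * a) (t n a) (n ∸ n / a) ⟩
    2 * a * t n a + 2 * a * (n ∸ n / a)      ≡⟨ cong (λ x → 2 * a * t n a + x) (*-assoc 2 a (n ∸ n / a)) ⟩
    2 * a * t n a + 2 * (a * (n ∸ n / a))    ≡⟨ cong (λ x → 2 * a * t n a + 2 * x) (a*[n∸n/a] n) ⟩
    2 * a * t n a + 2 * (b * n + n % a)      ∎
    where open ≡-Reasoning

  -- From `n` to `suc n`, 2a t grows by 2bn + 2 (n % a) and b n² by 2bn + b. As 0 ≤ n % a ≤ b, their
  -- difference changes by at most `b` per step, in either direction; the opposite bound has the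
  -- same proof.
  b*n²≤2a*t+b*n : ∀ n → b * n ^ 2 ≤ 2 * a * t n a + b * n
  b*n²≤2a*t+b*n zero    = ≤-trans (≤-reflexive (*-zeroʳ b)) z≤n
  b*n²≤2a*t+b*n (suc n) = begin
    b * suc n ^ 2
      ≡⟨ solve 2 (λ b n → b :* ((con 1 :+ n) :* ((con 1 :+ n) :* con 1))
           := b :* (n :* (n :* con 1)) :+ (con 2 :* (b :* n) :+ b)) refl b n ⟩
    b * n ^ 2 + (2 * (b * n) + b)
      ≤⟨ +-mono-≤ (b*n²≤2a*t+b*n n) (+-monoˡ-≤ b (*-monoʳ-≤ 2 (m≤m+n (b * n) (n % a)))) ⟩
    2 * a * t n a + b * n + (2 * (b * n + n % a) + b)
      ≡⟨ solve 4 (λ T b n S → T :+ b :* n :+ (S :+ b) := T :+ S :+ b :* (con 1 :+ n))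
           refl (2 * a * t n a) b n (2 * (b * n + n % a)) ⟩
    2 * a * t n a + 2 * (b * n + n % a) + b * suc n
      ≡⟨ cong (_+ b * suc n) (sym (2a*t-suc n)) ⟩
    2 * a * t (suc n) a + b * suc n ∎
    where
    open ≤-Reasoning
    open +-*-Solver

  2a*t≤b*n²+b*n : ∀ n → 2 * a * t n a ≤ b * n ^ 2 + b * n
  2a*t≤b*n²+b*n zero    = ≤-trans (≤-reflexive (*-zeroʳ (2 * a))) z≤n
  2a*t≤b*n²+b*n (suc n) = begin
    2 * a * t (suc n) a
      ≡⟨ 2a*t-suc n ⟩
    2 * a * t n a + 2 * (b * n + n % a)
      ≤⟨ +-mono-≤ (2a*t≤b*n²+b*n n) (*-monoʳ-≤ 2 (+-monoʳ-≤ (b * n) (≤-pred (m%n<n n a)))) ⟩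
    b * n ^ 2 + b * n + 2 * (b * n + b)
      ≡⟨ solve 2 (λ b n → b :* (n :* (n :* con 1)) :+ b :* n :+ con 2 :* (b :* n :+ b)
           := b :* ((con 1 :+ n) :* ((con 1 :+ n) :* con 1)) :+ b :* (con 1 :+ n)) refl b n ⟩
    b * suc n ^ 2 + b * suc n ∎
    where
    open ≤-Reasoning
    open +-*-Solver

  module _ (n : ℕ) {m : ℕ} where

    2a*m≤ : m ≤ t n a ∸ 1 → 2 * a * m ≤ b * n ^ 2 + b * (2 + b) * n
    2a*m≤ m≤ = begin
      2 * a * m                       ≤⟨ *-monoʳ-≤ (2 * a) (≤-trans m≤ (m∸n≤m (t n a) 1)) ⟩
      2 * a * t n a                   ≤⟨ 2a*t≤b*n²+b*n n ⟩
      -- The error term is enlarged to that of `≤2a*m`, so that a single `E` serves both directions.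
      b * n ^ 2 + b * n               ≤⟨ +-monoʳ-≤ (b * n ^ 2) (*-monoˡ-≤ n (m≤m*n b (2 + b))) ⟩
      b * n ^ 2 + b * (2 + b) * n     ∎
      where open ≤-Reasoning

    -- The error is b n from the Turán size plus 2a (n/a) (a C 2) ≤ n a b from the removed edges;
    -- with a = 1 + b the sum is at most b (2 + b) n.
    ≤2a*m : t n a ∸ (n / a) * (a C 2) ≤ m → b * n ^ 2 ≤ 2 * a * m + b * (2 + b) * n
    ≤2a*m ≤m = begin
      b * n ^ 2
        ≤⟨ b*n²≤2a*t+b*n n ⟩
      2 * a * t n a + b * n
        ≤⟨ +-monoˡ-≤ (b * n) (*-monoʳ-≤ (2 * a) (≤-trans (m≤n+m∸n (t n a) (n / a * (a C 2)))
             (+-monoʳ-≤ (n / a * (a C 2)) ≤m))) ⟩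
      2 * a * (n / a * (a C 2) + m) + b * n
        ≡⟨ solve 6 (λ a q c m b n → con 2 :* a :* (q :* c :+ m) :+ b :* n
             := con 2 :* a :* m :+ (q :* a :* (con 2 :* c) :+ b :* n)) refl a (n / a) (a C 2) m b n ⟩
      2 * a * m + (n / a * a * (2 * (a C 2)) + b * n)
        ≡⟨ cong (λ x → 2 * a * m + (n / a * a * x + b * n)) (2*[1+n]C2 b) ⟩
      2 * a * m + (n / a * a * (a * b) + b * n)
        ≤⟨ +-monoʳ-≤ (2 * a * m) (+-monoˡ-≤ (b * n) (*-monoˡ-≤ (a * b) (m/n*n≤m n a))) ⟩
      2 * a * m + (n * (a * b) + b * n)
        ≡⟨ cong (λ x → 2 * a * m + x) (solve 2 (λ n b → n :* ((con 1 :+ b) :* b) :+ b :* n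
             := b :* (con 2 :+ b) :* n) refl n b) ⟩
      2 * a * m + b * (2 + b) * n ∎
      where
      open ≤-Reasoning
      open +-*-Solver

mex-asymptotics : ∀ a .{{_ : NonZero a}} → a ≥ 2 →
  ∀ (mex : ℕ → ℕ) → (∀ n → n ≥ a ^ 2 + 1 → IsMex n a (mex n)) →
  (λ n → + mex n ℚ./ 1) ∼ (λ n → (1ℚ ℚ.- + 1 ℚ./ a) ℚ.* (+ (n ^ 2) ℚ./ 2))
mex-asymptotics a@(suc b@(suc _)) a≥2 mex isMex ε 0<ε =
  -- The summand `a ^ 2 + 1` makes the bounds on mex available. The other one makes the error b (2 +
  -- b) n, times the denominator of `ε`, smaller than b n²; the 1 makes this strict.
  a ^ 2 + 1 + (2 + b) * ℚ.↧ₙ ε , λ n N≤n →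
    let n≥ = ≤-trans (m≤m+n (a ^ 2 + 1) _) N≤n
        lower , upper = mex-bounds a≥2 n≥ (isMex n n≥)
    in  ÷-near-1 {D = + (2 * a) ℚ./ 1} {X = 2 * a * mex n} {E = b * (2 + b) * n} ε
          (ι-* (2 * a) (mex n)) (density-* b n)
          (2a*m≤ b n upper) (≤2a*m b n lower) 0<ε (error< n N≤n)
  where
  error< : ∀ n → a ^ 2 + 1 + (2 + b) * ℚ.↧ₙ ε ≤ n → b * (2 + b) * n * ℚ.↧ₙ ε < b * n ^ 2
  error< n N≤n = subst₂ _<_
    (solve 3 (λ b n q → b :* n :* ((con 2 :+ b) :* q) := b :* (con 2 :+ b) :* n :* q) refl b n (ℚ.↧ₙ ε))
    (solve 2 (λ b n → b :* n :* n := b :* (n :* (n :* con 1))) refl b n)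
    (*-monoʳ-< (b * n) {{m*n≢0 b n {{_}} {{ℕ.>-nonZero (≤-<-trans z≤n q<n)}}}} q<n)
    where
    open +-*-Solver
    q<n : (2 + b) * ℚ.↧ₙ ε < n
    q<n = ≤-trans (+-monoˡ-≤ ((2 + b) * ℚ.↧ₙ ε) (m≤n+m 1 (a ^ 2))) N≤n
mex-asymptotics (suc zero) (s≤s ())

theorem3p5 : ∀ (a : ℕ) .{{_ : NonZero a}} → a ≥ 2 →
    (∀ n → n ≥ a ^ 2 + 1 →
    ∃[ m ] IsMex n a m
    × t n a ∸ (n / a) * (a C 2) ≤ m
    × m ≤ t n a ∸ 1)
    × (∀ (mex : ℕ → ℕ) → (∀ n → n ≥ a ^ 2 + 1 → IsMex n a (mex n)) →
    (λ n → + mex n ℚ./ 1) ∼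
    (λ n → (1ℚ ℚ.- + 1 ℚ./ a) ℚ.* (+ (n ^ 2) ℚ./ 2)))
theorem3p5 a a≥2 =
  (λ n n≥ → let m , isMex = mex-exists a≥2 n≥ in m , isMex , mex-bounds a≥2 n≥ isMex) ,
  mex-asymptotics a a≥2
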